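{- Let $G$ be a multigraph (multiple edges allowed, no loops) with maximum degree $\Delta(G)$, let $k\ge 1$ be an integer, and let the palette be $\mathcal{K}=\{1,\dots,\lfloor \tfrac32\Delta(G)+\tfrac12 k\rfloor\}$. Let $S\subseteq E(G)$ carry a proper edge-colouring with colours from $\mathcal{K}$ such that every vertex of $G$ is incident with at most $k$ edges of $S$. Then this precolouring can be extended to a proper edge-colouring of all of $G$ using only colours from $\mathcal{K}$.
   Context: A proper edge-colouring assigns colours to edges so that any two edges sharing an end-vertex (including parallel edges) receive distinct colours. Extending a precolouring means producing a proper edge-colouring of all of $G$ agreeing with the given colours on $S$. -}

module Defs where

open import Data.Nat using (ℕ; _+_; _*_; _≤_; _/_)
open import Data.Fin using (Fin)
open import Data.Fin.Properties using (_≟_)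
open import Data.Product using (_×_; _,_; proj₁; proj₂; Σ; ∃)
open import Data.Sum using (_⊎_)
open import Data.Maybe using (Maybe; just; nothing)
open import Data.List using (List; length; filter)
open import Data.List.Base using (allFin)
open import Relation.Binary.PropositionalEquality using (_≡_; _≢_)
open import Relation.Nullary using (Dec; ¬_)
open import Relation.Nullary.Decidable using (_⊎-dec_)

-- A finite loopless multigraph: vertices Fin n, edges Fin m (distinct
-- edge identities, so parallel edges are allowed), each edge has two
-- distinct end-vertices.
record Multigraph : Set where
  field
    n     : ℕ
    m     : ℕ
    ends  : Fin m → Fin n × Fin n
    loopless : (e : Fin m) → proj₁ (ends e) ≢ proj₂ (ends e)
open Multigraph public

IncidentTo : (G : Multigraph) → Fin (n G) → Fin (m G) → Set
IncidentTo G v e = (proj₁ (ends G e) ≡ v) ⊎ (proj₂ (ends G e) ≡ v)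

incident? : (G : Multigraph) → (v : Fin (n G)) → (e : Fin (m G)) → Dec (IncidentTo G v e)
incident? G v e = (proj₁ (ends G e) ≟ v) ⊎-dec (proj₂ (ends G e) ≟ v)

incidentEdges : (G : Multigraph) → Fin (n G) → List (Fin (m G))
incidentEdges G v = filter (incident? G v) (allFin (m G))

degree : (G : Multigraph) → Fin (n G) → ℕ
degree G v = length (incidentEdges G v)

IsMaxDegree : (G : Multigraph) → ℕ → Set
IsMaxDegree G Δ = ((v : Fin (n G)) → degree G v ≤ Δ)
                × (n G ≡ 0 ⊎ ∃ λ v → degree G v ≡ Δ)

Adjacent : (G : Multigraph) → Fin (m G) → Fin (m G) → Set
Adjacent G e f = e ≢ f × ∃ λ v → IncidentTo G v e × IncidentTo G v f

ProperColouring : (G : Multigraph) → (C : Set) → (Fin (m G) → C) → Set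
ProperColouring G C c = ∀ e f → Adjacent G e f → c e ≢ c f

InS : (G : Multigraph) {C : Set} → (Fin (m G) → Maybe C) → Fin (m G) → Set
InS G pre e = ∃ λ a → pre e ≡ just a

ProperPrecolouring : (G : Multigraph) (C : Set) → (Fin (m G) → Maybe C) → Set
ProperPrecolouring G C pre =
  ∀ e f a b → Adjacent G e f → pre e ≡ just a → pre f ≡ just b → a ≢ b

sDegree : (G : Multigraph) {C : Set} → (Fin (m G) → Maybe C) → Fin (n G) → ℕ
sDegree G pre v = length (filter isJust? (incidentEdges G v))
  where
    open import Data.Maybe using (is-just)
    open import Data.Bool using (T)
    open import Relation.Nullary.Decidable using (T?)
    isJust? : (e : Fin (m G)) → Dec (T (is-just (pre e)))
    isJust? e = T? (is-just (pre e))

Extends : (G : Multigraph) {C : Set} → (Fin (m G) → Maybe C) → (Fin (m G) → C) → Set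
Extends G pre c = ∀ e a → pre e ≡ just a → c e ≡ a

-- palette size ⌊ (3/2)Δ + k/2 ⌋ = ⌊ (3Δ + k) / 2 ⌋
paletteSize : ℕ → ℕ → ℕ
paletteSize Δ k = (3 * Δ + k) / 2

{-# OPTIONS --safe #-}
module Submission where

open import Defs
open import Data.Nat using (ℕ; zero; suc; _+_; _*_; _∸_; _/_; _≤_; _<_; z≤n; s≤s; _≤?_; _<?_)
open import Data.Nat.Properties
open import Data.Nat.DivMod using (m*n/n≡m; /-monoˡ-≤; +-distrib-/-∣ˡ)
open import Data.Nat.Divisibility using (divides-refl)
open import Data.Nat.Solver using (module +-*-Solver)
open import Data.Bool using (Bool; true; false; not; if_then_else_; T)
open import Data.Bool.Properties using (not-¬; not-involutive) renaming (_≟_ to _≟ᴮ_)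
open import Data.Fin using (Fin; toℕ; fromℕ<)
import Data.Fin.Properties as Fin
open import Data.Maybe using (Maybe; just; is-just; maybe′)
open import Data.Product using (Σ; ∃; _×_; _,_; proj₁; proj₂)
open import Data.Sum as Sum using (_⊎_; inj₁; inj₂)
open import Data.List using (List; []; _∷_; _++_; length; filter; downFrom; allFin)
open import Data.List.Extrema.Nat using (argmax; argmax-sel; f[xs]≤f[argmax]; f[⊥]≤f[argmax])
open import Data.List.Properties using (filter-++; length-++; filter-notAll; length-filter; ++-assoc; ++-identityʳ)
import Data.List.Membership.DecPropositional as DecMembership
open import Data.List.Membership.Propositional using (_∈_; _∉_; find; lose)
open import Data.List.Membership.Propositional.Properties using (∈-filter⁺; ∈-filter⁻; ∈-++⁺ʳ; ∈-++⁻; ∈-downFrom⁻; ∈-allFin)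
open import Data.List.Relation.Unary.All as All using (All; all?)
import Data.List.Relation.Unary.All.Properties as All
open import Data.List.Relation.Unary.AllPairs as AllPairs using ()
open import Data.List.Relation.Unary.Any using (here; there; any?)
open import Data.List.Relation.Unary.Unique.Propositional using (Unique)
open import Data.List.Relation.Unary.Unique.Propositional.Properties using (downFrom⁺; allFin⁺; Unique[x∷xs]⇒x∉xs)
open import Data.List.Relation.Binary.Permutation.Propositional using (_↭_; prep; ↭-sym; ↭-trans; ↭-refl; ↭-reflexive; ↭⇒↭ₛ)
open import Data.List.Relation.Binary.Permutation.Propositional.Properties using (filter-↭; ↭-length; shift; shifts; ∈-resp-↭; ++⁺ˡ; ++⁺ʳ; ++-comm)
import Data.List.Relation.Binary.Permutation.Setoid.Properties as Permutationₛ
open import Function using (_∘_; id)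
open import Relation.Binary.Definitions using (DecidableEquality; tri<; tri≈; tri>)
open import Relation.Binary.PropositionalEquality
open import Relation.Nullary using (¬_; Dec; yes; no; contradiction)
open import Relation.Nullary.Decidable using (_×-dec_; _⊎-dec_; _→-dec_; ¬?; T?)
open import Relation.Unary using (Decidable)

open +-*-Solver using (solve; _:+_; _:*_; _:=_; con)

-- Let T = ⌊(Δ + k)/2⌋, so that the palette has Δ + T colours. Choose a locally maximal cut of the uncoloured edges:
-- at every vertex at most half of the uncoloured edges lie inside a part, hence at most T edges are precoloured or
-- inside a part. Colour the inside edges greedily, and go on with crossing edges as long as both ends have fewer
-- than T coloured edges. The rest is bipartite, and each of its edges has an end v at which T edges are coloured and
-- at most r = Δ − T are not.
--
-- The rest is coloured from the lists of still available colours by Galvin's method: if for some preference of the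
-- edges at every vertex each list is longer than the number of preferred edges at the two ends, stable matchings
-- yield a colouring. For the preference take a maximal set N of remaining edges with at most r edges at every vertex
-- and an r-edge-colouring of N (König). Edges of higher colour are preferred in the first part and edges of lower
-- colour in the second; an edge outside N is placed so that it is preferred at an end where N has r edges.

-- Counting in lists

module _ {A : Set} where

  # : {P : A → Set} → Decidable P → List A → ℕ
  # P? xs = length (filter P? xs)

  #-++ : {P : A → Set} (P? : Decidable P) (xs ys : List A) → # P? (xs ++ ys) ≡ # P? xs + # P? ys
  #-++ P? xs ys = trans (cong length (filter-++ P? xs ys)) (length-++ (filter P? xs))

  #-↭ : {P : A → Set} (P? : Decidable P) {xs ys : List A} → xs ↭ ys → # P? xs ≡ # P? ys
  #-↭ P? xs↭ys = ↭-length (filter-↭ P? xs↭ys)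

  module _ {P Q : A → Set} (P? : Decidable P) (Q? : Decidable Q) where

    #-mono : (xs : List A) → (∀ {x} → x ∈ xs → P x → Q x) → # P? xs ≤ # Q? xs
    #-mono []       P⊆Q = z≤n
    #-mono (x ∷ xs) P⊆Q with ih ← #-mono xs (P⊆Q ∘ there) | P? x | Q? x
    ... | yes _  | yes _  = s≤s ih
    ... | yes px | no ¬qx = contradiction (P⊆Q (here refl) px) ¬qx
    ... | no _   | yes _  = m≤n⇒m≤1+n ih
    ... | no _   | no _   = ih

    #-filter : (xs : List A) → # P? (filter Q? xs) ≡ # (λ x → P? x ×-dec Q? x) xs
    #-filter []       = refl
    #-filter (x ∷ xs) with Q? x
    #-filter (x ∷ xs) | no _ with P? x
    ... | yes _ = #-filter xs
    ... | no _  = #-filter xs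
    #-filter (x ∷ xs) | yes _ with P? x
    ... | yes _ = cong suc (#-filter xs)
    ... | no _  = #-filter xs

    module _ {R : A → Set} (R? : Decidable R) where

      #-disjoint : (xs : List A) → (∀ {x} → x ∈ xs → P x → R x) → (∀ {x} → x ∈ xs → Q x → R x) →
        (∀ {x} → x ∈ xs → P x → ¬ Q x) → # P? xs + # Q? xs ≤ # R? xs
      #-disjoint []       P⊆R Q⊆R P#Q = z≤n
      #-disjoint (x ∷ xs) P⊆R Q⊆R P#Q
        with ih ← #-disjoint xs (P⊆R ∘ there) (Q⊆R ∘ there) (P#Q ∘ there) | P? x | Q? x | R? x
      ... | yes px | yes qx | _      = contradiction qx (P#Q (here refl) px)
      ... | yes px | no _   | no ¬rx = contradiction (P⊆R (here refl) px) ¬rx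
      ... | no _   | yes qx | no ¬rx = contradiction (Q⊆R (here refl) qx) ¬rx
      ... | yes _  | no _   | yes _  = s≤s ih
      ... | no _   | yes _  | yes _  = ≤-trans (≤-reflexive (+-suc _ _)) (s≤s ih)
      ... | no _   | no _   | yes _  = m≤n⇒m≤1+n ih
      ... | no _   | no _   | no _   = ih

      #-cover : (xs : List A) → (∀ {x} → x ∈ xs → R x → P x ⊎ Q x) → # R? xs ≤ # P? xs + # Q? xs
      #-cover []       R⊆P∪Q = z≤n
      #-cover (x ∷ xs) R⊆P∪Q with ih ← #-cover xs (R⊆P∪Q ∘ there) | P? x | Q? x | R? x
      ... | no ¬px | no ¬qx | yes rx = case-no (R⊆P∪Q (here refl) rx)
        where case-no : _ ⊎ _ → _
              case-no (inj₁ px) = contradiction px ¬px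
              case-no (inj₂ qx) = contradiction qx ¬qx
      ... | yes _ | yes _ | yes _ = s≤s (≤-trans ih (+-monoʳ-≤ (# P? xs) (n≤1+n _)))
      ... | yes _ | no _  | yes _ = s≤s ih
      ... | no _  | yes _ | yes _ = ≤-trans (s≤s ih) (≤-reflexive (sym (+-suc _ _)))
      ... | yes _ | yes _ | no _  = m≤n⇒m≤1+n (≤-trans ih (+-monoʳ-≤ (# P? xs) (n≤1+n _)))
      ... | yes _ | no _  | no _  = m≤n⇒m≤1+n ih
      ... | no _  | yes _ | no _  = ≤-trans (m≤n⇒m≤1+n ih) (≤-reflexive (sym (+-suc _ _)))
      ... | no _  | no _  | no _  = ih

  module _ {P : A → Set} (P? : Decidable P) where

    #-accept : {x : A} (xs : List A) → P x → # P? (x ∷ xs) ≡ suc (# P? xs)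
    #-accept {x} xs px with P? x
    ... | yes _  = refl
    ... | no ¬px = contradiction px ¬px

    #-reject : {x : A} (xs : List A) → ¬ P x → # P? (x ∷ xs) ≡ # P? xs
    #-reject {x} xs ¬px with P? x
    ... | yes px = contradiction px ¬px
    ... | no _   = refl

    #-tail : (x : A) (xs : List A) → # P? xs ≤ # P? (x ∷ xs)
    #-tail x xs with P? x
    ... | yes _ = n≤1+n _
    ... | no _  = ≤-refl

    #-witness : (xs : List A) → 0 < # P? xs → ∃ λ x → x ∈ xs × P x
    #-witness (x ∷ xs) 0<# with P? x
    ... | yes px = x , here refl , px
    ... | no _   with y , y∈ , py ← #-witness xs 0<# = y , there y∈ , py

    #-none : (xs : List A) → (∀ {x} → x ∈ xs → ¬ P x) → # P? xs ≡ 0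
    #-none []       none = refl
    #-none (x ∷ xs) none with P? x
    ... | yes px = contradiction px (none (here refl))
    ... | no _   = #-none xs (none ∘ there)

    #-atMostOne : {xs : List A} → Unique xs → (∀ {x y} → x ∈ xs → y ∈ xs → P x → P y → x ≡ y) → # P? xs ≤ 1
    #-atMostOne {[]}     u       same = z≤n
    #-atMostOne {x ∷ xs} u@(_ AllPairs.∷ u') same with P? x
    ... | no _   = #-atMostOne u' (λ y∈ z∈ → same (there y∈) (there z∈))
    ... | yes px = s≤s (≤-reflexive (#-none xs λ y∈ py →
            Unique[x∷xs]⇒x∉xs u (subst (_∈ xs) (sym (same (here refl) (there y∈) px py)) y∈)))

    #-strict : {Q : A → Set} (Q? : Decidable Q) (xs : List A) → (∀ {x} → x ∈ xs → P x → Q x) →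
      {x : A} → x ∈ xs → ¬ P x → Q x → # P? xs < # Q? xs
    #-strict Q? (y ∷ xs) P⊆Q (here refl) ¬px qx with P? y | Q? y
    ... | yes px | _      = contradiction px ¬px
    ... | no _   | no ¬qx = contradiction qx ¬qx
    ... | no _   | yes _  = s≤s (#-mono P? Q? xs (P⊆Q ∘ there))
    #-strict Q? (y ∷ xs) P⊆Q (there x∈) ¬px qx
      with ih ← #-strict Q? xs (P⊆Q ∘ there) x∈ ¬px qx | P? y | Q? y
    ... | yes _  | yes _  = s≤s ih
    ... | yes py | no ¬qy = contradiction (P⊆Q (here refl) py) ¬qy
    ... | no _   | yes _  = m≤n⇒m≤1+n ih
    ... | no _   | no _   = ih

  #-interval : {P : A → Set} (P? : Decidable P) {xs : List A} → Unique xs → (f : A → ℕ) (lo k : ℕ) →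
    (∀ {x} → x ∈ xs → P x → lo ≤ f x × f x < lo + k) →
    (∀ {x y} → x ∈ xs → y ∈ xs → P x → P y → f x ≡ f y → x ≡ y) → # P? xs ≤ k
  #-interval P? {xs} u f lo zero bounds inj =
    ≤-reflexive (#-none P? xs λ x∈ px → let l , h = bounds x∈ px in
      <⇒≱ h (≤-trans (≤-reflexive (+-identityʳ lo)) l))
  #-interval P? {xs} u f lo (suc k) bounds inj = begin
      # P? xs
    ≤⟨ #-cover below? top? P? xs (λ {x} x∈ px → split px (f x ≟ lo + k) (bounds x∈ px)) ⟩
      # below? xs + # top? xs
    ≤⟨ +-mono-≤
         (#-interval below? u f lo k (λ x∈ (px , h) → proj₁ (bounds x∈ px) , h)
            (λ x∈ y∈ (px , _) (py , _) → inj x∈ y∈ px py))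
         (#-atMostOne top? u λ x∈ y∈ (px , fx) (py , fy) → inj x∈ y∈ px py (trans fx (sym fy))) ⟩
      k + 1
    ≡⟨ +-comm k 1 ⟩
      suc k
    ∎
    where
      open ≤-Reasoning
      -- The largest admissible value `lo + k` is split off: it is attained at most once, and the
      -- remaining values lie in an interval of length `k`.
      below? = λ x → P? x ×-dec (f x <? lo + k)
      top? = λ x → P? x ×-dec (f x ≟ lo + k)
      split : ∀ {x} → _ → Dec (f x ≡ lo + k) → lo ≤ f x × f x < lo + suc k → (_ × f x < lo + k) ⊎ (_ × f x ≡ lo + k)
      split px (yes eq) _ = inj₂ (px , eq)
      split px (no neq) (_ , h) = inj₁ (px , ≤∧≢⇒< (≤-pred (<-≤-trans h (≤-reflexive (+-suc lo k)))) neq)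

module _ {A : Set} where

  unused? : {P : A → Set} (P? : Decidable P) (f : A → ℕ) (xs : List A) (γ : ℕ) → Dec (¬ (∃ λ x → x ∈ xs × P x × f x ≡ γ))
  unused? P? f xs γ with any? (λ x → P? x ×-dec (f x ≟ γ)) xs
  ... | yes used = no λ ¬used → ¬used (find used)
  ... | no ¬used = yes λ (x , x∈ , px , fx) → ¬used (lose x∈ (px , fx))

  #-unused : {P : A → Set} (P? : Decidable P) (f : A → ℕ) (xs : List A) (K : ℕ) →
    K ≤ # (unused? P? f xs) (downFrom K) + # P? xs
  #-unused P? f xs zero = z≤n
  #-unused {P} P? f xs (suc K) with unused? P? f xs K
  ... | yes _  = s≤s (#-unused P? f xs K)
  ... | no used = begin
      suc K
    ≤⟨ s≤s (#-unused P'? f xs K) ⟩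
      suc (# (unused? P'? f xs) (downFrom K) + # P'? xs)
    ≤⟨ s≤s (+-monoˡ-≤ _ (#-mono (unused? P'? f xs) (unused? P? f xs) (downFrom K)
         λ γ∈ ¬used (x , x∈ , px , fx≡γ) → ¬used (x , x∈ , (px , λ fx≡K → <⇒≢ (∈-downFrom⁻ γ∈) (trans (sym fx≡γ) fx≡K)) , fx≡γ))) ⟩
      suc (# (unused? P? f xs) (downFrom K) + # P'? xs)
    ≡⟨ sym (+-suc _ _) ⟩
      # (unused? P? f xs) (downFrom K) + suc (# P'? xs)
    ≤⟨ +-monoʳ-≤ _ fewer ⟩
      # (unused? P? f xs) (downFrom K) + # P? xs
    ∎
    where
      open ≤-Reasoning
      P'? : Decidable (λ x → P x × f x ≢ K)
      P'? x = P? x ×-dec ¬? (f x ≟ K)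
      fewer : # P'? xs < # P? xs
      fewer with any? (λ x → P? x ×-dec (f x ≟ K)) xs
      ... | yes any with x , x∈ , px , fx≡K ← find any = #-strict P'? P? xs (λ _ → proj₁) x∈ (λ p' → proj₂ p' fx≡K) px
      ... | no ¬any = contradiction (λ (x , x∈ , px , fx≡K) → ¬any (lose x∈ (px , fx≡K))) used

  freeColour : {P : A → Set} (P? : Decidable P) (f : A → ℕ) (xs : List A) {K : ℕ} → # P? xs < K →
    ∃ λ γ → γ < K × ¬ (∃ λ x → x ∈ xs × P x × f x ≡ γ)
  freeColour P? f xs {K} #<K
    with γ , γ∈ , free ← #-witness (unused? P? f xs) (downFrom K)
           (+-cancelʳ-< (# P? xs) 0 _ (<-≤-trans #<K (#-unused P? f xs K)))
    = γ , ∈-downFrom⁻ γ∈ , free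

-- Galvin's method

-- Properness at one family of ends. In a bipartite graph a colouring is proper when it separates
-- both families `a` and `b`.
Separates : {E V C : Set} → (E → V) → (E → C) → List E → Set
Separates a c es = ∀ {x y} → x ∈ es → y ∈ es → a x ≡ a y → c x ≡ c y → x ≡ y

module Galvin {E V W : Set} (_≟ᴱ_ : DecidableEquality E) (_≟ⱽ_ : DecidableEquality V) (_≟ᵂ_ : DecidableEquality W)
  (a : E → V) (b : E → W) (key : E → ℕ) (key-injective : ∀ {x y} → key x ≡ key y → x ≡ y) where

  open DecMembership _≟ᴱ_ using (_∈?_)

  -- One key serves both sides: larger keys are preferred at `a`-ends and smaller keys at `b`-ends.
  -- This orients the line graph towards preferred edges, and `rank` is the out-degree.
  AboveAt BelowAt : E → E → Set
  AboveAt e f = a f ≡ a e × key e < key f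
  BelowAt e f = b f ≡ b e × key f < key e

  aboveAt? : ∀ e → Decidable (AboveAt e)
  aboveAt? e f = (a f ≟ⱽ a e) ×-dec (key e <? key f)

  belowAt? : ∀ e → Decidable (BelowAt e)
  belowAt? e f = (b f ≟ᵂ b e) ×-dec (key f <? key e)

  rank : E → List E → ℕ
  rank e es = # (aboveAt? e) es + # (belowAt? e) es

  Top : List E → E → Set
  Top F t = All (λ f → a f ≡ a t → key f ≤ key t) F

  top? : ∀ F → Decidable (Top F)
  top? F t = all? (λ f → (a f ≟ⱽ a t) →-dec (key f ≤? key t)) F

  topAbove : ∀ F {e} → e ∈ F → ∃ λ t → t ∈ F × Top F t × a t ≡ a e × key e ≤ key t
  topAbove F {e} e∈ = t , proj₁ t∈,at , top , proj₂ t∈,at , f[⊥]≤f[argmax] {f = key} e siblings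
    where
    siblings = filter (λ f → a f ≟ⱽ a e) F
    t = argmax key e siblings
    t∈,at : t ∈ F × a t ≡ a e
    t∈,at with argmax-sel key e siblings
    ... | inj₁ t≡e = subst (_∈ F) (sym t≡e) e∈ , cong a t≡e
    ... | inj₂ t∈  = ∈-filter⁻ (λ f → a f ≟ⱽ a e) t∈
    top : Top F t
    top = All.tabulate λ {f} f∈ af≡at → All.lookup (f[xs]≤f[argmax] {f = key} e siblings)
            (∈-filter⁺ (λ f → a f ≟ⱽ a e) f∈ (trans af≡at (proj₂ t∈,at)))

  Dominated : List E → E → Set
  Dominated M e = ∃ λ f → f ∈ M × (AboveAt e f ⊎ BelowAt e f)

  -- A stable matching in the sense of Gale and Shapley; equivalently, a kernel of the oriented line
  -- graph of `F`.
  record Kernel (F : List E) : Set where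
    field
      members   : List E
      subset    : ∀ {x} → x ∈ members → x ∈ F
      matchingᵃ : ∀ {x y} → x ∈ members → y ∈ members → a x ≡ a y → x ≡ y
      matchingᵇ : ∀ {x y} → x ∈ members → y ∈ members → b x ≡ b y → x ≡ y
      absorbs   : ∀ {x} → x ∈ F → x ∈ members ⊎ Dominated members x

  open Kernel

  -- If no edge of `F` has a top edge preferred to it at its `b`-end, the top edges are the kernel:
  -- two of them at one `b`-end would clash, and every other edge has a top edge above it. Otherwise
  -- an edge `e` beaten at its `b`-end by a top edge `f` is deleted, since every kernel of the
  -- remaining edges dominates `e` as well. The number `n` bounds the recursion.
  kernel : ∀ n F → length F ≤ n → Kernel F
  kernel _ [] _ = record { members = [] ; subset = λ () ; matchingᵃ = λ () ; matchingᵇ = λ () ; absorbs = λ () }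
  kernel (suc n) F@(_ ∷ _) len with any? (λ e → any? (λ f → belowAt? e f ×-dec top? F f) F) F
  ... | no noClash = record
    { members   = filter (top? F) F
    ; subset    = proj₁ ∘ ∈-filter⁻ (top? F)
    ; matchingᵃ = λ x∈ y∈ → top-unique (∈-filter⁻ (top? F) x∈) (∈-filter⁻ (top? F) y∈)
    ; matchingᵇ = λ x∈ y∈ → matching (∈-filter⁻ (top? F) x∈) (∈-filter⁻ (top? F) y∈)
    ; absorbs   = absorb
    }
    where
    top-unique : ∀ {x y} → x ∈ F × Top F x → y ∈ F × Top F y → a x ≡ a y → x ≡ y
    top-unique (x∈ , tx) (y∈ , ty) ax≡ay =
      key-injective (≤-antisym (All.lookup ty x∈ ax≡ay) (All.lookup tx y∈ (sym ax≡ay)))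
    matching : ∀ {x y} → x ∈ F × Top F x → y ∈ F × Top F y → b x ≡ b y → x ≡ y
    matching {x} {y} (x∈ , tx) (y∈ , ty) bx≡by = key-injective (≤-antisym
      (≮⇒≥ λ y<x → noClash (lose x∈ (lose y∈ ((sym bx≡by , y<x) , ty))))
      (≮⇒≥ λ x<y → noClash (lose y∈ (lose x∈ ((bx≡by , x<y) , tx)))))
    absorb : ∀ {x} → x ∈ F → x ∈ filter (top? F) F ⊎ Dominated (filter (top? F) F) x
    absorb {x} x∈ with t , t∈ , tt , at≡ax , x≤t ← topAbove F x∈ | x ≟ᴱ t
    ... | yes refl = inj₁ (∈-filter⁺ (top? F) t∈ tt)
    ... | no x≢t   = inj₂ (t , ∈-filter⁺ (top? F) t∈ tt , inj₁ (at≡ax , ≤∧≢⇒< x≤t (x≢t ∘ key-injective)))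
  ... | yes clash with e , e∈ , clash' ← find clash
    with f , f∈ , (bf≡be , f<e) , tf ← find clash' = record
    { members   = members K
    ; subset    = proj₁ ∘ ∈-filter⁻ (λ x → ¬? (x ≟ᴱ e)) ∘ subset K
    ; matchingᵃ = matchingᵃ K
    ; matchingᵇ = matchingᵇ K
    ; absorbs   = absorb
    }
    where
    F' = filter (λ x → ¬? (x ≟ᴱ e)) F
    K : Kernel F'
    K = kernel n F' (≤-pred (<-≤-trans (filter-notAll (λ x → ¬? (x ≟ᴱ e)) F (lose e∈ (λ e≢e → e≢e refl))) len))
    -- f stays top after e is removed, so only edges below f at b f = b e can dominate f.
    e-dominated : f ∈ members K ⊎ Dominated (members K) f → Dominated (members K) e
    e-dominated (inj₁ f∈K) = f , f∈K , inj₂ (bf≡be , f<e)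
    e-dominated (inj₂ (g , g∈K , inj₁ (ag≡af , f<g))) =
      contradiction (All.lookup tf (proj₁ (∈-filter⁻ (λ x → ¬? (x ≟ᴱ e)) (subset K g∈K))) ag≡af) (<⇒≱ f<g)
    e-dominated (inj₂ (g , g∈K , inj₂ (bg≡bf , g<f))) = g , g∈K , inj₂ (trans bg≡bf bf≡be , <-trans g<f f<e)
    absorb : ∀ {x} → x ∈ F → x ∈ members K ⊎ Dominated (members K) x
    absorb {x} x∈ with x ≟ᴱ e
    ... | no x≢e   = absorbs K (∈-filter⁺ (λ x → ¬? (x ≟ᴱ e)) x∈ x≢e)
    ... | yes refl = inj₂ (e-dominated (absorbs K (∈-filter⁺ (λ x → ¬? (x ≟ᴱ e)) f∈ λ f≡e → <⇒≢ f<e (cong key f≡e))))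

  -- Induction on the palette: the edges that admit the first colour `γ` have a kernel, which
  -- receives `γ` and is removed. The value `γ₀` fills in the edges outside `es`.
  listColouring : {C : Set} {Q : E → C → Set} (Q? : ∀ e → Decidable (Q e)) → C →
    (cs : List C) → Unique cs → (es : List E) → (∀ {e} → e ∈ es → rank e es < # (Q? e) cs) →
    Σ (E → C) λ c → (∀ {e} → e ∈ es → c e ∈ cs × Q e (c e)) × Separates a c es × Separates b c es
  listColouring Q? γ₀ [] _ [] _ = (λ _ → γ₀) , (λ ()) , (λ ()) , (λ ())
  listColouring Q? γ₀ [] _ (_ ∷ _) large = contradiction (large (here refl)) λ ()
  listColouring {C} {Q} Q? γ₀ (γ ∷ cs) u@(_ AllPairs.∷ u') es large =
    c' , avail' , sep a (matchingᵃ K) sepᵃ , sep b (matchingᵇ K) sepᵇ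
    where
    F = filter (λ e → Q? e γ) es
    K = kernel (length F) F ≤-refl
    rest? = λ e → ¬? (e ∈? members K)
    rest = filter rest? es
    inRest : ∀ {x} → x ∈ es → x ∉ members K → x ∈ rest
    inRest = ∈-filter⁺ rest?
    K⊆es : ∀ {x} → x ∈ members K → x ∈ es
    K⊆es = proj₁ ∘ ∈-filter⁻ (λ e → Q? e γ) ∘ subset K
    shrinks : {P : E → Set} (P? : Decidable P) → # P? rest ≤ # P? es
    shrinks P? = ≤-trans (≤-reflexive (#-filter P? rest? es)) (#-mono _ P? es λ _ → proj₁)
    shrinks< : {P : E → Set} (P? : Decidable P) {x : E} → x ∈ members K → P x → # P? rest < # P? es
    shrinks< P? x∈K px = ≤-trans (≤-reflexive (cong suc (#-filter P? rest? es)))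
      (#-strict _ P? es (λ _ → proj₁) (K⊆es x∈K) (λ (_ , x∉) → x∉ x∈K) px)
    rank-dominated : ∀ {e} → Dominated (members K) e → rank e rest < rank e es
    rank-dominated {e} (f , f∈K , inj₁ above) = +-mono-<-≤ (shrinks< (aboveAt? e) f∈K above) (shrinks (belowAt? e))
    rank-dominated {e} (f , f∈K , inj₂ below) = +-mono-≤-< (shrinks (aboveAt? e)) (shrinks< (belowAt? e) f∈K below)
    -- An edge that does not admit `γ` keeps its list, and its rank does not grow. One that admits
    -- `γ` loses a colour, but also a kernel edge that dominated it, so the strict inequality
    -- survives.
    large' : ∀ {e} → e ∈ rest → rank e rest < # (Q? e) cs
    large' {e} e∈ with e∈es , e∉K ← ∈-filter⁻ rest? e∈ with large e∈es
    ... | rank< with Q? e γ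
    ...   | no _  = ≤-<-trans (+-mono-≤ (shrinks (aboveAt? e)) (shrinks (belowAt? e))) rank<
    ...   | yes q with absorbs K (∈-filter⁺ (λ e → Q? e γ) e∈es q)
    ...     | inj₁ e∈K = contradiction e∈K e∉K
    ...     | inj₂ dom = <-≤-trans (rank-dominated dom) (≤-pred rank<)
    ih = listColouring Q? γ₀ cs u' rest large'
    c = proj₁ ih
    avail = proj₁ (proj₂ ih)
    sepᵃ = proj₁ (proj₂ (proj₂ ih))
    sepᵇ = proj₂ (proj₂ (proj₂ ih))
    c' : E → C
    c' e with e ∈? members K
    ... | yes _ = γ
    ... | no _  = c e
    avail' : ∀ {e} → e ∈ es → c' e ∈ γ ∷ cs × Q e (c' e)
    avail' {e} e∈ with e ∈? members K
    ... | yes e∈K = here refl , proj₂ (∈-filter⁻ (λ e → Q? e γ) {xs = es} (subset K e∈K))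
    ... | no e∉K  = there (proj₁ (avail (inRest e∈ e∉K))) , proj₂ (avail (inRest e∈ e∉K))
    γ-new : ∀ {x} → x ∈ es → x ∉ members K → c x ≢ γ
    γ-new x∈ x∉K cx≡γ = Unique[x∷xs]⇒x∉xs u (subst (_∈ cs) cx≡γ (proj₁ (avail (inRest x∈ x∉K))))
    sep : {X : Set} (end : E → X) → (∀ {x y} → x ∈ members K → y ∈ members K → end x ≡ end y → x ≡ y) →
      Separates end c rest → Separates end c' es
    sep end matching sepʳ {x} {y} x∈ y∈ same c≡ with x ∈? members K | y ∈? members K
    ... | yes x∈K | yes y∈K = matching x∈K y∈K same
    ... | yes _   | no y∉K  = contradiction (sym c≡) (γ-new y∈ y∉K)
    ... | no x∉K  | yes _   = contradiction c≡ (γ-new x∈ x∉K)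
    ... | no x∉K  | no y∉K  = sepʳ (inRest x∈ x∉K) (inRest y∈ y∉K) same c≡

-- König's edge-colouring theorem

module Update {E : Set} (_≟ᴱ_ : DecidableEquality E) where

  _[_↦_] : {C : Set} → (E → C) → E → C → E → C
  (c [ e ↦ γ ]) x with x ≟ᴱ e
  ... | yes _ = γ
  ... | no _  = c x

  update-other : {C : Set} (c : E → C) {e x : E} (γ : C) → x ≢ e → (c [ e ↦ γ ]) x ≡ c x
  update-other c {e} {x} γ x≢e with x ≟ᴱ e
  ... | yes x≡e = contradiction x≡e x≢e
  ... | no _    = refl

  update-same : {C : Set} (c : E → C) (e : E) (γ : C) → (c [ e ↦ γ ]) e ≡ γ
  update-same c e γ with e ≟ᴱ e
  ... | yes _   = refl
  ... | no e≢e  = contradiction refl e≢e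

  -- The condition on `es'` covers both uses: putting `e` in front of `es`, and returning from a
  -- list with `e` deleted to the original one.
  Separates-update : {V C : Set} {a : E → V} {c : E → C} {es es' : List E} {e : E} {γ : C} →
    Separates a c es → (∀ {f} → f ∈ es → a f ≡ a e → c f ≢ γ) →
    (∀ {x} → x ∈ es' → x ≢ e → x ∈ es) → Separates a (c [ e ↦ γ ]) es'
  Separates-update {e = e} sep fresh sub {x} {y} x∈ y∈ same c≡ with x ≟ᴱ e | y ≟ᴱ e
  ... | yes refl | yes refl = refl
  ... | yes refl | no y≢e   = contradiction (sym c≡) (fresh (sub y∈ y≢e) (sym same))
  ... | no x≢e   | yes refl = contradiction c≡ (fresh (sub x∈ x≢e) same)
  ... | no x≢e   | no y≢e   = sep (sub x∈ x≢e) (sub y∈ y≢e) same c≡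

-- Maximum degree two, expressed through elements rather than counts, so that it passes directly to
-- sublists and to merged ends.
AtMostTwo : {E V : Set} → (E → V) → List E → Set
AtMostTwo a es = ∀ {x y z} → x ∈ es → y ∈ es → z ∈ es → a x ≡ a y → a y ≡ a z → x ≡ y ⊎ y ≡ z ⊎ x ≡ z

AtMostTwo-third : {E V : Set} {a : E → V} {es : List E} → AtMostTwo a es →
  ∀ {x y z} → x ∈ es → y ∈ es → z ∈ es → x ≢ y → x ≢ z → a x ≡ a y → a x ≡ a z → y ≡ z
AtMostTwo-third two x∈ y∈ z∈ x≢y x≢z xy xz with two x∈ y∈ z∈ xy (trans (sym xy) xz)
... | inj₁ x≡y        = contradiction x≡y x≢y
... | inj₂ (inj₁ y≡z) = y≡z
... | inj₂ (inj₂ x≡z) = contradiction x≡z x≢z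

module König {E V W : Set} (_≟ᴱ_ : DecidableEquality E) (_≟ⱽ_ : DecidableEquality V) (_≟ᵂ_ : DecidableEquality W) where

  open Update _≟ᴱ_

  _∖_ : List E → E → List E
  es ∖ e = filter (λ x → ¬? (x ≟ᴱ e)) es

  ∈-∖⁺ : ∀ {es e x} → x ∈ es → x ≢ e → x ∈ es ∖ e
  ∈-∖⁺ {e = e} = ∈-filter⁺ (λ x → ¬? (x ≟ᴱ e))

  ∈-∖⁻ : ∀ es {e x} → x ∈ es ∖ e → x ∈ es × x ≢ e
  ∈-∖⁻ es {e} = ∈-filter⁻ (λ x → ¬? (x ≟ᴱ e)) {xs = es}

  module Merge (b : E → W) (e₁ e₂ : E) where

    merged : E → W
    merged x with b x ≟ᵂ b e₂
    ... | yes _ = b e₁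
    ... | no _  = b x

    merged-₁ : ∀ {x} → b x ≡ b e₁ → merged x ≡ b e₁
    merged-₁ {x} bx≡ with b x ≟ᵂ b e₂
    ... | yes _ = refl
    ... | no _  = bx≡

    merged-₂ : ∀ {x} → b x ≡ b e₂ → merged x ≡ b e₁
    merged-₂ {x} bx≡ with b x ≟ᵂ b e₂
    ... | yes _ = refl
    ... | no ≢  = contradiction bx≡ ≢

    merged-cong : ∀ {x y} → b x ≡ b y → merged x ≡ merged y
    merged-cong {x} {y} x≡y with b x ≟ᵂ b e₂ | b y ≟ᵂ b e₂
    ... | yes _  | yes _  = refl
    ... | yes x≡ | no y≢  = contradiction (trans (sym x≡y) x≡) y≢
    ... | no x≢  | yes y≡ = contradiction (trans x≡y y≡) x≢
    ... | no _   | no _   = x≡y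

    merged-inv : ∀ x → (merged x ≡ b e₁ × b x ≡ b e₂) ⊎ merged x ≡ b x
    merged-inv x with b x ≟ᵂ b e₂
    ... | yes bx≡ = inj₁ (refl , bx≡)
    ... | no _    = inj₂ refl

    merged-at : ∀ {x} → merged x ≡ b e₁ → b x ≡ b e₂ ⊎ b x ≡ b e₁
    merged-at {x} m with merged-inv x
    ... | inj₁ (_ , bx≡) = inj₁ bx≡
    ... | inj₂ m≡b       = inj₂ (trans (sym m≡b) m)

    merged-away : ∀ {x} → merged x ≢ b e₁ → merged x ≡ b x
    merged-away {x} m≢ with merged-inv x
    ... | inj₁ (m≡ , _) = contradiction m≡ m≢
    ... | inj₂ m≡b      = m≡b

    -- Each of the two identified ends carries at most one edge of `es`, so among three edges at the
    -- merged end two come from the same original end and coincide.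
    merged-atMostTwo : ∀ {es} → AtMostTwo b es →
      (∀ {f g} → f ∈ es → g ∈ es → b f ≡ b e₁ → b g ≡ b e₁ → f ≡ g) →
      (∀ {f g} → f ∈ es → g ∈ es → b f ≡ b e₂ → b g ≡ b e₂ → f ≡ g) → AtMostTwo merged es
    merged-atMostTwo two one₁ one₂ {x} {y} {z} x∈ y∈ z∈ xy yz with merged x ≟ᵂ b e₁
    ... | no x≢ = two x∈ y∈ z∈
            (trans (sym (merged-away x≢)) (trans xy (merged-away y≢)))
            (trans (sym (merged-away y≢)) (trans yz (merged-away (y≢ ∘ trans yz))))
      where y≢ = x≢ ∘ trans xy
    ... | yes x≡ with merged-at x≡ | merged-at (trans (sym xy) x≡) | merged-at (trans (sym yz) (trans (sym xy) x≡))
    ...   | inj₁ x₂ | inj₁ y₂ | _       = inj₁ (one₂ x∈ y∈ x₂ y₂)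
    ...   | inj₂ x₁ | inj₂ y₁ | _       = inj₁ (one₁ x∈ y∈ x₁ y₁)
    ...   | inj₁ _  | inj₂ y₁ | inj₂ z₁ = inj₂ (inj₁ (one₁ y∈ z∈ y₁ z₁))
    ...   | inj₁ x₂ | inj₂ _  | inj₁ z₂ = inj₂ (inj₂ (one₂ x∈ z∈ x₂ z₂))
    ...   | inj₂ _  | inj₁ y₂ | inj₁ z₂ = inj₂ (inj₁ (one₂ y∈ z∈ y₂ z₂))
    ...   | inj₂ x₁ | inj₁ _  | inj₂ z₁ = inj₂ (inj₂ (one₁ x∈ z∈ x₁ z₁))

  -- Two edges e₁, e₂ at a common a-vertex are deleted and their b-ends merged; a colouring of the rest then
  -- gives the remaining edges at these two b-ends different colours, which leaves two different colours for e₁ and e₂.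
  twoColouring : ∀ n (es : List E) → length es ≤ n → (a : E → V) (b : E → W) → AtMostTwo a es → AtMostTwo b es →
    Σ (E → Bool) λ c → Separates a c es × Separates b c es
  twoColouring _ [] _ a b _ _ = (λ _ → true) , (λ ()) , (λ ())
  twoColouring (suc n) es@(e₁ ∷ tail) len a b twoᵃ twoᵇ with any? (λ x → (a x ≟ⱽ a e₁) ×-dec ¬? (x ≟ᴱ e₁)) es
  -- With `e₁` alone at its `a`-end, only its `b`-end restricts the colour, and at most one other
  -- edge lies there.
  ... | no alone = c [ e₁ ↦ β ]
      , Separates-update sepᵃ (λ f∈ af≡ → contradiction (lose (proj₁ (∈-∖⁻ es f∈)) (af≡ , proj₂ (∈-∖⁻ es f∈))) alone) ∈-∖⁺
      , Separates-update sepᵇ fresh ∈-∖⁺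
    where
    rest = es ∖ e₁
    rest⊆ : ∀ {x} → x ∈ rest → x ∈ es
    rest⊆ = proj₁ ∘ ∈-∖⁻ es
    ih = twoColouring n rest
      (≤-pred (<-≤-trans (filter-notAll (λ x → ¬? (x ≟ᴱ e₁)) es (here λ e≢e → e≢e refl)) len)) a b
      (λ x∈ y∈ z∈ → twoᵃ (rest⊆ x∈) (rest⊆ y∈) (rest⊆ z∈)) (λ x∈ y∈ z∈ → twoᵇ (rest⊆ x∈) (rest⊆ y∈) (rest⊆ z∈))
    c = proj₁ ih
    sepᵃ = proj₁ (proj₂ ih)
    sepᵇ = proj₂ (proj₂ ih)
    avoid : ∃ λ β → ∀ {f} → f ∈ rest → b f ≡ b e₁ → c f ≢ β
    avoid with any? (λ f → b f ≟ᵂ b e₁) rest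
    ... | no none = true , λ f∈ bf≡ → contradiction (lose f∈ bf≡) none
    ... | yes some with g , g∈ , bg≡ ← find some = not (c g) , λ {f} f∈ bf≡ cf≡ →
            not-¬ refl (trans (cong c (AtMostTwo-third twoᵇ (here refl) (rest⊆ g∈) (rest⊆ f∈)
              (≢-sym (proj₂ (∈-∖⁻ es g∈))) (≢-sym (proj₂ (∈-∖⁻ es f∈))) (sym bg≡) (sym bf≡))) cf≡)
    β = proj₁ avoid
    fresh = λ {f} → proj₂ avoid {f}
  ... | yes pair with e₂ , e₂∈ , a₂≡ , e₂≢ ← find pair = (c [ e₂ ↦ not β ]) [ e₁ ↦ β ]
      , Separates-update (Separates-update sepᵃ freshᵃ₂ ∈-∖⁺) freshᵃ₁ ∈-∖⁺
      , Separates-update (Separates-update sepᵇ (proj₂ (proj₂ avoid)) ∈-∖⁺) freshᵇ₁ ∈-∖⁺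
    where
    open Merge b e₁ e₂
    rest = (es ∖ e₁) ∖ e₂
    rest⊆ : ∀ {x} → x ∈ rest → x ∈ es × e₁ ≢ x × e₂ ≢ x
    rest⊆ x∈ with x∈' , x≢e₂ ← ∈-∖⁻ (es ∖ e₁) x∈ with x∈'' , x≢e₁ ← ∈-∖⁻ es x∈' = x∈'' , ≢-sym x≢e₁ , ≢-sym x≢e₂
    one₁ : ∀ {f g} → f ∈ rest → g ∈ rest → b f ≡ b e₁ → b g ≡ b e₁ → f ≡ g
    one₁ f∈ g∈ bf bg with f∈ , e≢f , _ ← rest⊆ f∈ | g∈ , e≢g , _ ← rest⊆ g∈ =
      AtMostTwo-third twoᵇ (here refl) f∈ g∈ e≢f e≢g (sym bf) (sym bg)
    one₂ : ∀ {f g} → f ∈ rest → g ∈ rest → b f ≡ b e₂ → b g ≡ b e₂ → f ≡ g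
    one₂ f∈ g∈ bf bg with f∈ , _ , e≢f ← rest⊆ f∈ | g∈ , _ , e≢g ← rest⊆ g∈ =
      AtMostTwo-third twoᵇ e₂∈ f∈ g∈ e≢f e≢g (sym bf) (sym bg)
    -- This concerns parallel `e₁` and `e₂`: their common `b`-end already carries two edges, so no
    -- edge of `rest` reaches it.
    both : ∀ {f} → f ∈ rest → b f ≡ b e₁ → b f ≢ b e₂
    both f∈ b₁ b₂ with f∈' , e₁≢f , e₂≢f ← rest⊆ f∈ =
      e₂≢f (AtMostTwo-third twoᵇ (here refl) e₂∈ f∈' (≢-sym e₂≢) e₁≢f (trans (sym b₁) b₂) (sym b₁))
    ih = twoColouring n rest
      (≤-trans (length-filter (λ x → ¬? (x ≟ᴱ e₂)) (es ∖ e₁))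
        (≤-pred (<-≤-trans (filter-notAll (λ x → ¬? (x ≟ᴱ e₁)) es (here λ e≢e → e≢e refl)) len))) a merged
      (λ x∈ y∈ z∈ → twoᵃ (proj₁ (rest⊆ x∈)) (proj₁ (rest⊆ y∈)) (proj₁ (rest⊆ z∈)))
      (merged-atMostTwo (λ x∈ y∈ z∈ → twoᵇ (proj₁ (rest⊆ x∈)) (proj₁ (rest⊆ y∈)) (proj₁ (rest⊆ z∈))) one₁ one₂)
    c = proj₁ ih
    sepᵃ = proj₁ (proj₂ ih)
    sepᵇ : Separates b c rest
    sepᵇ x∈ y∈ = proj₂ (proj₂ ih) x∈ y∈ ∘ merged-cong
    differ : ∀ {f g} → f ∈ rest → g ∈ rest → b f ≡ b e₁ → b g ≡ b e₂ → c f ≢ c g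
    differ f∈ g∈ bf bg cf≡cg = both f∈ bf
      (trans (cong b (proj₂ (proj₂ ih) f∈ g∈ (trans (merged-₁ bf) (sym (merged-₂ bg))) cf≡cg)) bg)
    -- Each of the two `b`-ends carries at most one edge of `rest`. If both do, their colours differ
    -- by `differ`, so the choice of `β` forced at one end also suits `not β` at the other.
    avoid : ∃ λ β → (∀ {f} → f ∈ rest → b f ≡ b e₁ → c f ≢ β) × (∀ {f} → f ∈ rest → b f ≡ b e₂ → c f ≢ not β)
    avoid with any? (λ f → b f ≟ᵂ b e₁) rest | any? (λ f → b f ≟ᵂ b e₂) rest
    ... | no none₁  | no none₂ = true , (λ f∈ bf≡ → contradiction (lose f∈ bf≡) none₁)
                                      , (λ f∈ bf≡ → contradiction (lose f∈ bf≡) none₂)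
    ... | yes some₁ | _ with g , g∈ , bg≡ ← find some₁ = not (c g)
            , (λ f∈ bf≡ → not-¬ (cong c (one₁ f∈ g∈ bf≡ bg≡)))
            , (λ f∈ bf≡ cf≡ → differ g∈ f∈ bg≡ bf≡ (sym (trans cf≡ (not-involutive (c g)))))
    avoid | no none₁ | yes some₂ with g , g∈ , bg≡ ← find some₂ = c g
            , (λ f∈ bf≡ → contradiction (lose f∈ bf≡) none₁)
            , (λ f∈ bf≡ → not-¬ (cong c (one₂ f∈ g∈ bf≡ bg≡)))
    β = proj₁ avoid
    noThird : ∀ {f} → f ∈ rest → a f ≢ a e₁
    noThird f∈ af≡ with f∈' , e₁≢f , e₂≢f ← rest⊆ f∈ =
      e₂≢f (AtMostTwo-third twoᵃ (here refl) e₂∈ f∈' (≢-sym e₂≢) e₁≢f (sym a₂≡) (sym af≡))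
    freshᵃ₂ : ∀ {f} → f ∈ rest → a f ≡ a e₂ → c f ≢ not β
    freshᵃ₂ f∈ af≡ = contradiction (trans af≡ a₂≡) (noThird f∈)
    freshᵃ₁ : ∀ {f} → f ∈ es ∖ e₁ → a f ≡ a e₁ → (c [ e₂ ↦ not β ]) f ≢ β
    freshᵃ₁ {f} f∈ af≡ with f ≟ᴱ e₂
    ... | yes _  = not-¬ refl ∘ sym
    ... | no f≢ = contradiction af≡ (noThird (∈-∖⁺ f∈ f≢))
    freshᵇ₁ : ∀ {f} → f ∈ es ∖ e₁ → b f ≡ b e₁ → (c [ e₂ ↦ not β ]) f ≢ β
    freshᵇ₁ {f} f∈ bf≡ with f ≟ᴱ e₂
    ... | yes _  = not-¬ refl ∘ sym
    ... | no f≢ = proj₁ (proj₂ avoid) (∈-∖⁺ f∈ f≢) bf≡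

  -- Pigeonhole: of three edges at one end, two share one of the two colours.
  AtMostTwo-colours : {X C : Set} {end : E → X} {c : E → C} {es : List E} {α β : C} → Separates end c es →
    (∀ {x} → x ∈ es → c x ≡ α ⊎ c x ≡ β) → AtMostTwo end es
  AtMostTwo-colours sep αβ x∈ y∈ z∈ xy yz with αβ x∈ | αβ y∈ | αβ z∈
  ... | inj₁ x≡ | inj₁ y≡ | _       = inj₁ (sep x∈ y∈ xy (trans x≡ (sym y≡)))
  ... | inj₂ x≡ | inj₂ y≡ | _       = inj₁ (sep x∈ y∈ xy (trans x≡ (sym y≡)))
  ... | inj₁ _  | inj₂ y≡ | inj₂ z≡ = inj₂ (inj₁ (sep y∈ z∈ yz (trans y≡ (sym z≡))))
  ... | inj₂ _  | inj₁ y≡ | inj₁ z≡ = inj₂ (inj₁ (sep y∈ z∈ yz (trans y≡ (sym z≡))))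
  ... | inj₁ x≡ | inj₂ _  | inj₁ z≡ = inj₂ (inj₂ (sep x∈ z∈ (trans xy yz) (trans x≡ (sym z≡))))
  ... | inj₂ x≡ | inj₁ _  | inj₂ z≡ = inj₂ (inj₂ (sep x∈ z∈ (trans xy yz) (trans x≡ (sym z≡))))

  -- This replaces the usual alternating-path argument: instead of swapping `α` and `β` along one
  -- path, all edges of these two colours are recoloured together with `e`.
  module Insert (a : E → V) (b : E → W) {r : ℕ} (e : E) (es : List E) (c : E → ℕ)
    (c<r : ∀ {x} → x ∈ es → c x < r) (sepᵃ : Separates a c es) (sepᵇ : Separates b c es)
    {α β : ℕ} (α<r : α < r) (β<r : β < r)
    (α-free : ∀ {x} → x ∈ es → a x ≡ a e → c x ≢ α) (β-free : ∀ {x} → x ∈ es → b x ≡ b e → c x ≢ β) where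

    old : ∀ {x} → x ∈ e ∷ es → x ≢ e → x ∈ es
    old (here x≡e) x≢e = contradiction x≡e x≢e
    old (there x∈) _   = x∈

    sepᵃα : Separates a (c [ e ↦ α ]) (e ∷ es)
    sepᵃα = Separates-update sepᵃ α-free old

    sepᵇβ : Separates b (c [ e ↦ β ]) (e ∷ es)
    sepᵇβ = Separates-update sepᵇ β-free old

    bounded : ∀ {γ} → γ < r → ∀ {x} → x ∈ e ∷ es → (c [ e ↦ γ ]) x < r
    bounded γ<r {x} x∈ with x ≟ᴱ e
    ... | yes _  = γ<r
    ... | no x≢e = c<r (old x∈ x≢e)

    module Switch (α≢β : α ≢ β) where
      Affected : E → Set
      Affected x = x ≡ e ⊎ (c x ≡ α ⊎ c x ≡ β)
      affected? : Decidable Affected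
      affected? x = (x ≟ᴱ e) ⊎-dec ((c x ≟ α) ⊎-dec (c x ≟ β))
      affected = filter affected? (e ∷ es)
      recoloured : ∀ {γ} → γ ≡ α ⊎ γ ≡ β → ∀ {x} → x ∈ affected → (c [ e ↦ γ ]) x ≡ α ⊎ (c [ e ↦ γ ]) x ≡ β
      recoloured γ {x} x∈ with x ≟ᴱ e | ∈-filter⁻ affected? {xs = e ∷ es} x∈
      ... | yes _  | _              = γ
      ... | no _   | _ , inj₂ cx    = cx
      ... | no x≢e | _ , inj₁ x≡e   = contradiction x≡e x≢e
      affected⊆ : ∀ {x} → x ∈ affected → x ∈ e ∷ es
      affected⊆ = proj₁ ∘ ∈-filter⁻ affected?
      -- Giving `e` the colour `α` is proper at the `a`-ends and giving it `β` is proper at the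
      -- `b`-ends. Either way the affected edges have only two colours, hence at most two of them
      -- meet at any end.
      two = twoColouring (length affected) affected ≤-refl a b
        (AtMostTwo-colours (λ x∈ y∈ → sepᵃα (affected⊆ x∈) (affected⊆ y∈)) (recoloured (inj₁ refl)))
        (AtMostTwo-colours (λ x∈ y∈ → sepᵇβ (affected⊆ x∈) (affected⊆ y∈)) (recoloured (inj₂ refl)))
      d = proj₁ two
      value : Bool → ℕ
      value t = if t then α else β
      value-injective : ∀ s t → value s ≡ value t → s ≡ t
      value-injective true  true  _  = refl
      value-injective false false _  = refl
      value-injective true  false eq = contradiction eq α≢β
      value-injective false true  eq = contradiction (sym eq) α≢β
      value-affected : ∀ {x} t → c x ≡ value t → Affected x
      value-affected true  eq = inj₂ (inj₁ eq)
      value-affected false eq = inj₂ (inj₂ eq)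
      value<r : ∀ t → value t < r
      value<r true  = α<r
      value<r false = β<r
      c' : E → ℕ
      c' x with affected? x
      ... | yes _ = value (d x)
      ... | no _  = c x
      c'<r : ∀ {x} → x ∈ e ∷ es → c' x < r
      c'<r {x} x∈ with affected? x
      ... | yes _  = value<r (d x)
      ... | no ¬af = c<r (old x∈ (¬af ∘ inj₁))
      sep : {X : Set} (end : E → X) → Separates end d affected → Separates end c es → Separates end c' (e ∷ es)
      sep end sepᵈ sepᶜ {x} {y} x∈ y∈ same c≡ with affected? x | affected? y
      ... | yes ax | yes ay = sepᵈ (∈-filter⁺ affected? x∈ ax) (∈-filter⁺ affected? y∈ ay) same (value-injective _ _ c≡)
      ... | yes _  | no ¬ay = contradiction (value-affected (d x) (sym c≡)) ¬ay
      ... | no ¬ax | yes _  = contradiction (value-affected (d y) c≡) ¬ax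
      ... | no ¬ax | no ¬ay = sepᶜ (old x∈ (¬ax ∘ inj₁)) (old y∈ (¬ay ∘ inj₁)) same c≡

    inserted : Σ (E → ℕ) λ c' → (∀ {x} → x ∈ e ∷ es → c' x < r) × Separates a c' (e ∷ es) × Separates b c' (e ∷ es)
    inserted with α ≟ β
    ... | yes α≡β = c [ e ↦ α ] , bounded α<r , sepᵃα
                  , subst (λ γ → Separates b (c [ e ↦ γ ]) (e ∷ es)) (sym α≡β) sepᵇβ
    ... | no α≢β  = c' , c'<r , sep a (proj₁ (proj₂ two)) sepᵃ , sep b (proj₂ (proj₂ two)) sepᵇ
      where open Switch α≢β

  könig : (a : E → V) (b : E → W) (r : ℕ) (es : List E) →
    (∀ v → # (λ e → a e ≟ⱽ v) es ≤ r) → (∀ w → # (λ e → b e ≟ᵂ w) es ≤ r) →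
    Σ (E → ℕ) λ c → (∀ {e} → e ∈ es → c e < r) × Separates a c es × Separates b c es
  könig a b r [] degᵃ degᵇ = (λ _ → 0) , (λ ()) , (λ ()) , (λ ())
  könig a b r (e ∷ es) degᵃ degᵇ
    with c , c<r , sepᵃ , sepᵇ ← könig a b r es (λ v → ≤-trans (#-tail (λ e → a e ≟ⱽ v) e es) (degᵃ v))
                                                (λ w → ≤-trans (#-tail (λ e → b e ≟ᵂ w) e es) (degᵇ w))
    -- The edge `e` counts towards the degree of both its ends, so fewer than `r` edges of `es` lie
    -- at each of them and a colour is free there.
    with α , α<r , α-free ← freeColour (λ x → a x ≟ⱽ a e) c es
           (<-≤-trans (≤-reflexive (sym (#-accept (λ x → a x ≟ⱽ a e) es refl))) (degᵃ (a e)))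
       | β , β<r , β-free ← freeColour (λ x → b x ≟ᵂ b e) c es
           (<-≤-trans (≤-reflexive (sym (#-accept (λ x → b x ≟ᵂ b e) es refl))) (degᵇ (b e)))
    = Insert.inserted a b e es c c<r sepᵃ sepᵇ α<r β<r
        (λ x∈ ax cx → α-free (_ , x∈ , ax , cx)) (λ x∈ bx cx → β-free (_ , x∈ , bx , cx))

-- Greedy steps and the cut

filter-partition : {A : Set} {P : A → Set} (P? : Decidable P) (xs : List A) →
  filter P? xs ++ filter (¬? ∘ P?) xs ↭ xs
filter-partition P? []       = ↭-refl
filter-partition P? (x ∷ xs) with P? x
... | yes _ = prep x (filter-partition P? xs)
... | no _  = ↭-trans (shift x (filter P? xs) _) (prep x (filter-partition P? xs))

module Incidence {E V : Set} (_≟ⱽ_ : DecidableEquality V) (p q : E → V) where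

  Inc : V → E → Set
  Inc v e = p e ≡ v ⊎ q e ≡ v

  inc? : ∀ v → Decidable (Inc v)
  inc? v e = (p e ≟ⱽ v) ⊎-dec (q e ≟ⱽ v)

  -- A maximal choice of edges under the degree bound `b`, with `zs` counted in advance: every edge
  -- left over is blocked at one of its ends. It yields the crossing edges coloured greedily and,
  -- later, the set `N` that is coloured by König's theorem.
  record Saturation (b : ℕ) (zs es : List E) : Set where
    field
      taken left : List E
      split      : taken ++ left ↭ es
      bounded    : ∀ v → # (inc? v) (taken ++ zs) ≤ b
      saturated  : ∀ {e} → e ∈ left → b ≤ # (inc? (p e)) (taken ++ zs) ⊎ b ≤ # (inc? (q e)) (taken ++ zs)

  saturate : ∀ b zs es → (∀ v → # (inc? v) zs ≤ b) → Saturation b zs es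
  saturate b zs [] bound = record { taken = [] ; left = [] ; split = ↭-refl ; bounded = bound ; saturated = λ () }
  saturate b zs (e ∷ es) bound = extend
      ((# (inc? (p e)) (taken ++ zs) <? b) ×-dec (# (inc? (q e)) (taken ++ zs) <? b))
    where
    open Saturation (saturate b zs es bound)
    extend : Dec (# (inc? (p e)) (taken ++ zs) < b × # (inc? (q e)) (taken ++ zs) < b) → Saturation b zs (e ∷ es)
    extend (yes (p< , q<)) = record
      { taken = e ∷ taken ; left = left ; split = prep e split ; bounded = bounded'
      ; saturated = saturated' }
      where
      bounded' : ∀ v → # (inc? v) (e ∷ taken ++ zs) ≤ b
      bounded' v with inc? v e
      ... | no ¬inc = ≤-trans (≤-reflexive (#-reject (inc? v) _ ¬inc)) (bounded v)
      ... | yes (inj₁ refl) = ≤-trans (≤-reflexive (#-accept (inc? v) _ (inj₁ refl))) p<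
      ... | yes (inj₂ refl) = ≤-trans (≤-reflexive (#-accept (inc? v) _ (inj₂ refl))) q<
      grow : ∀ {v} → b ≤ # (inc? v) (taken ++ zs) → b ≤ # (inc? v) (e ∷ taken ++ zs)
      grow {v} le = ≤-trans le (#-tail (inc? v) e (taken ++ zs))
      saturated' : ∀ {f} → f ∈ left → b ≤ # (inc? (p f)) (e ∷ taken ++ zs) ⊎ b ≤ # (inc? (q f)) (e ∷ taken ++ zs)
      saturated' {f} f∈ = Sum.map (grow {p f}) (grow {q f}) (saturated f∈)
    extend (no full) = record
      { taken = taken ; left = e ∷ left ; split = ↭-trans (shift e taken left) (prep e split) ; bounded = bounded
      ; saturated = saturated' }
      where
      saturated' : ∀ {f} → f ∈ e ∷ left → b ≤ # (inc? (p f)) (taken ++ zs) ⊎ b ≤ # (inc? (q f)) (taken ++ zs)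
      saturated' (there f∈) = saturated f∈
      saturated' (here refl) with # (inc? (p e)) (taken ++ zs) <? b
      ... | no p≮  = inj₁ (≮⇒≥ p≮)
      ... | yes p< = inj₂ (≮⇒≥ λ q< → full (p< , q<))

  Proper : {C : Set} → (E → C) → List E → Set
  Proper c es = ∀ {v x y} → x ∈ es → y ∈ es → Inc v x → Inc v y → c x ≡ c y → x ≡ y

  module _ (_≟ᴱ_ : DecidableEquality E) where

    open Update _≟ᴱ_

    open DecMembership _≟ᴱ_ using (_∈?_)

    Proper-++ : {C : Set} {c d : E → C} (ys zs : List E) → Proper c ys → Proper d zs →
      (∀ {v x y} → x ∈ ys → y ∈ zs → Inc v x → Inc v y → c x ≢ d y) →
      Σ (E → C) λ f → (∀ {e} → e ∈ ys → f e ≡ c e) × (∀ {e} → e ∈ zs → e ∉ ys → f e ≡ d e) × Proper f (ys ++ zs)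
    Proper-++ {C} {c} {d} ys zs c-proper d-proper apart = f , f≡c , f≡d , f-proper
      where
      f : E → C
      f e with e ∈? ys
      ... | yes _ = c e
      ... | no _  = d e
      f≡c : ∀ {e} → e ∈ ys → f e ≡ c e
      f≡c {e} e∈ with e ∈? ys
      ... | yes _ = refl
      ... | no e∉ = contradiction e∈ e∉
      f≡d : ∀ {e} → e ∈ zs → e ∉ ys → f e ≡ d e
      f≡d {e} _ e∉ with e ∈? ys
      ... | yes e∈ = contradiction e∈ e∉
      ... | no _   = refl
      right : ∀ {e} → e ∈ ys ++ zs → e ∉ ys → e ∈ zs
      right e∈ e∉ = Sum.[ (λ e∈ys → contradiction e∈ys e∉) , id ] (∈-++⁻ ys e∈)
      f-proper : Proper f (ys ++ zs)
      f-proper {_} {x} {y} x∈ y∈ ix iy f≡ with x ∈? ys | y ∈? ys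
      ... | yes x∈ys | yes y∈ys = c-proper x∈ys y∈ys ix iy f≡
      ... | yes x∈ys | no y∉ys  = contradiction f≡ (apart x∈ys (right y∈ y∉ys) ix iy)
      ... | no x∉ys  | yes y∈ys = contradiction (sym f≡) (apart y∈ys (right x∈ x∉ys) iy ix)
      ... | no x∉ys  | no y∉ys  = d-proper (right x∈ x∉ys) (right y∈ y∉ys) ix iy f≡

    -- The two ends of an edge meet at most `K` edges in total, the edge itself among them, so fewer
    -- than `K` colours are forbidden when its turn comes.
    greedy : ∀ {K} (ys es : List E) (c : E → ℕ) → (∀ {e} → e ∈ ys → c e < K) → Proper c ys → Unique (es ++ ys) →
      (∀ u v → # (inc? u) (es ++ ys) + # (inc? v) (es ++ ys) ≤ K) →
      Σ (E → ℕ) λ c' → (∀ {e} → e ∈ ys → c' e ≡ c e) × (∀ {e} → e ∈ es ++ ys → c' e < K) × Proper c' (es ++ ys)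
    greedy ys [] c c<K proper u deg = c , (λ _ → refl) , c<K , proper
    greedy {K} ys (e ∷ es) c c<K proper u@(_ AllPairs.∷ u') deg
      with c' , keep , c'<K , proper' ← greedy ys es c c<K proper u'
             (λ u v → ≤-trans (+-mono-≤ (#-tail (inc? u) e _) (#-tail (inc? v) e _)) (deg u v))
      with γ , γ<K , free ← freeColour (λ x → inc? (p e) x ⊎-dec inc? (q e) x) c' (es ++ ys) (≤-<-trans
             (#-cover (inc? (p e)) (inc? (q e)) _ (es ++ ys) (λ _ → id))
             (<-≤-trans (+-mono-<-≤ (≤-reflexive (sym (#-accept (inc? (p e)) (es ++ ys) (inj₁ refl))))
                                    (#-tail (inc? (q e)) e (es ++ ys)))
                        (deg (p e) (q e))))
      = c' [ e ↦ γ ]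
      , (λ {x} x∈ → trans (update-other c' γ λ x≡e → new (subst (_∈ es ++ ys) x≡e (∈-++⁺ʳ es x∈))) (keep x∈))
      , bounded
      , proper″
      where
      new : e ∉ es ++ ys
      new = Unique[x∷xs]⇒x∉xs u
      old : ∀ {x} → x ∈ e ∷ es ++ ys → x ≢ e → x ∈ es ++ ys
      old (here x≡e) x≢e = contradiction x≡e x≢e
      old (there x∈) _   = x∈
      bounded : ∀ {x} → x ∈ e ∷ es ++ ys → (c' [ e ↦ γ ]) x < K
      bounded {x} x∈ with x ≟ᴱ e
      ... | yes _  = γ<K
      ... | no x≢e = c'<K (old x∈ x≢e)
      clash : ∀ {v x} → x ∈ es ++ ys → Inc v e → Inc v x → c' x ≢ γ
      clash x∈ (inj₁ refl) inc c≡ = free (_ , x∈ , inj₁ inc , c≡)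
      clash x∈ (inj₂ refl) inc c≡ = free (_ , x∈ , inj₂ inc , c≡)
      proper″ : Proper (c' [ e ↦ γ ]) (e ∷ es ++ ys)
      proper″ {_} {x} {y} x∈ y∈ ix iy c≡ with x ≟ᴱ e | y ≟ᴱ e
      ... | yes refl | yes refl = refl
      ... | yes refl | no y≢e   = contradiction (sym c≡) (clash (old y∈ y≢e) ix iy)
      ... | no x≢e   | yes refl = contradiction c≡ (clash (old x∈ x≢e) iy ix)
      ... | no x≢e   | no y≢e   = proper' (old x∈ x≢e) (old y∈ y≢e) ix iy c≡

-- Locally maximal cuts

module MaxCut {E : Set} {n : ℕ} (p q : E → Fin n) (loopless : ∀ e → p e ≢ q e) (es : List E) where

  open Incidence Fin._≟_ p q
  open Update (Fin._≟_ {n})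

  Cross : (Fin n → Bool) → E → Set
  Cross s e = s (p e) ≢ s (q e)

  cross? : ∀ s → Decidable (Cross s)
  cross? s e = ¬? (s (p e) ≟ᴮ s (q e))

  inner outer : (Fin n → Bool) → Fin n → ℕ
  inner s v = # (λ e → inc? v e ×-dec ¬? (cross? s e)) es
  outer s v = # (λ e → inc? v e ×-dec cross? s e) es

  -- Moving `v` across keeps the crossing edges away from `v` and makes the inner edges at `v`
  -- crossing, because without loops exactly one end of such an edge moves. The sum form avoids
  -- subtracting `outer s v`.
  flip-side : (s : Fin n → Bool) (v : Fin n) →
    # (cross? s) es + inner s v ≤ # (cross? (s [ v ↦ not (s v) ])) es + outer s v
  flip-side s v = begin
      # (cross? s) es + inner s v
    ≤⟨ +-monoˡ-≤ (inner s v) (#-cover away? _ (cross? s) es split) ⟩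
      # away? es + outer s v + inner s v
    ≡⟨ trans (+-assoc (# away? es) _ _) (trans (cong (# away? es +_) (+-comm (outer s v) _)) (sym (+-assoc (# away? es) _ _))) ⟩
      # away? es + inner s v + outer s v
    ≤⟨ +-monoˡ-≤ (outer s v) (#-disjoint away? _ (cross? s') es away-cross inner-cross (λ _ (_ , ¬inc) (inc , _) → ¬inc inc)) ⟩
      # (cross? s') es + outer s v
    ∎
    where
    open ≤-Reasoning
    s' = s [ v ↦ not (s v) ]
    away? = λ e → cross? s e ×-dec ¬? (inc? v e)
    split : ∀ {e} → e ∈ es → Cross s e → (Cross s e × ¬ Inc v e) ⊎ (Inc v e × Cross s e)
    split {e} _ cr with inc? v e
    ... | yes inc = inj₂ (inc , cr)
    ... | no ¬inc = inj₁ (cr , ¬inc)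
    away-cross : ∀ {e} → e ∈ es → Cross s e × ¬ Inc v e → Cross s' e
    away-cross _ (cr , ¬inc) eq = cr (trans (sym (update-other s _ (¬inc ∘ inj₁))) (trans eq (update-other s _ (¬inc ∘ inj₂))))
    inner-cross : ∀ {e} → e ∈ es → Inc v e × ¬ Cross s e → Cross s' e
    inner-cross {e} _ (inj₁ refl , ¬cr) eq = ¬cr λ same →
      not-¬ (sym same) (trans (sym (update-other s _ (≢-sym (loopless e)))) (trans (sym eq) (update-same s v _)))
    inner-cross {e} _ (inj₂ refl , ¬cr) eq = ¬cr λ same →
      not-¬ same (trans (sym (update-other s _ (loopless e))) (trans eq (update-same s v _)))

  -- Each flip at a vertex with more inner than outer edges enlarges the cut. The number `k` bounds
  -- the flips still possible: at zero all edges cross already, and a further gain would be absurd.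
  locallyMaximal : ∀ k (s : Fin n → Bool) → length es ≤ # (cross? s) es + k → ∃ λ s → ∀ v → inner s v ≤ outer s v
  locallyMaximal k s len with Fin.any? (λ v → outer s v <? inner s v)
  ... | no none = s , λ v → ≮⇒≥ λ lt → none (v , lt)
  ... | yes (v , lt) = climb k len
    where
    s' = s [ v ↦ not (s v) ]
    improved : # (cross? s) es < # (cross? s') es
    improved = +-cancelʳ-< (outer s v) _ _ (<-≤-trans (+-monoʳ-< (# (cross? s) es) lt) (flip-side s v))
    climb : ∀ k → length es ≤ # (cross? s) es + k → ∃ λ s → ∀ v → inner s v ≤ outer s v
    climb zero len = contradiction (≤-trans len (≤-reflexive (+-identityʳ _)))
                       (<⇒≱ (<-≤-trans improved (length-filter (cross? s') es)))
    climb (suc k) len = locallyMaximal k s' (≤-trans len (≤-trans (≤-reflexive (+-suc _ k)) (+-monoˡ-≤ k improved)))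

-- The preference on the uncoloured crossing edges

m+[n∸m]≤o : ∀ {m n o} → m ≤ o → n ≤ o → m + (n ∸ m) ≤ o
m+[n∸m]≤o {m} {n} m≤o n≤o with ≤-total m n
... | inj₁ m≤n = ≤-trans (≤-reflexive (m+[n∸m]≡n m≤n)) n≤o
... | inj₂ n≤m = ≤-trans (≤-reflexive (trans (cong (m +_) (m≤n⇒m∸n≡0 n≤m)) (+-identityʳ m))) m≤o

module Preference {m n : ℕ} (a b : Fin m → Fin n) (N X : List (Fin m)) (r : ℕ)
  (unique : Unique N) (disjoint : ∀ {e} → e ∈ X → e ∉ N)
  (bounded : ∀ v → # (Incidence.inc? Fin._≟_ a b v) N ≤ r)
  (saturated : ∀ {e} → e ∈ X → r ≤ # (Incidence.inc? Fin._≟_ a b (a e)) N ⊎ r ≤ # (Incidence.inc? Fin._≟_ a b (b e)) N)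
  where

  open Incidence {V = Fin n} Fin._≟_ a b
  open DecMembership (Fin._≟_ {m}) using (_∈?_)

  private
    coloured = König.könig (Fin._≟_ {m}) (Fin._≟_ {n}) (Fin._≟_ {n}) a b r N
      (λ v → ≤-trans (#-mono _ (inc? v) N λ _ → inj₁) (bounded v))
      (λ v → ≤-trans (#-mono _ (inc? v) N λ _ → inj₂) (bounded v))

  κ : Fin m → ℕ
  κ = proj₁ coloured

  κ<r : ∀ {e} → e ∈ N → κ e < r
  κ<r = proj₁ (proj₂ coloured)

  sepᵃ : Separates a κ N
  sepᵃ = proj₁ (proj₂ (proj₂ coloured))

  sepᵇ : Separates b κ N
  sepᵇ = proj₂ (proj₂ (proj₂ coloured))

  -- The edges of `N` occupy the levels 1 to `r`, which leaves 0 and `suc r` for `X`. Level 0 beats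
  -- all of `N` at the `b`-end and level `suc r` beats all of `N` at the `a`-end; the choice falls
  -- on an end that is saturated by `N`.
  level : Fin m → ℕ
  level e with e ∈? N | r ≤? # (inc? (b e)) N
  ... | yes _ | _     = suc (κ e)
  ... | no _  | yes _ = 0
  ... | no _  | no _  = suc r

  level-N : ∀ {e} → e ∈ N → level e ≡ suc (κ e)
  level-N {e} e∈ with e ∈? N | r ≤? # (inc? (b e)) N
  ... | yes _ | _ = refl
  ... | no e∉ | _ = contradiction e∈ e∉

  level-X : ∀ {e} → e ∈ X → level e ≡ 0 × r ≤ # (inc? (b e)) N ⊎ level e ≡ suc r × r ≤ # (inc? (a e)) N
  level-X {e} e∈ with e ∈? N | r ≤? # (inc? (b e)) N
  ... | yes e∈N | _       = contradiction e∈N (disjoint e∈)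
  ... | no _    | yes sat = inj₁ (refl , sat)
  ... | no _    | no ¬sat with saturated e∈
  ...   | inj₁ sat = inj₂ (refl , sat)
  ...   | inj₂ sat = contradiction sat ¬sat

  -- Lexicographic order by level and then by edge number, which is below `m`; the second component
  -- breaks ties and makes the key injective.
  key : Fin m → ℕ
  key e = level e * m + toℕ e

  key-mono : ∀ {e f} → level e < level f → key e < key f
  key-mono {e} {f} e<f = begin-strict
      level e * m + toℕ e
    <⟨ +-monoʳ-< (level e * m) (Fin.toℕ<n e) ⟩
      level e * m + m
    ≡⟨ +-comm (level e * m) m ⟩
      suc (level e) * m
    ≤⟨ *-monoˡ-≤ m e<f ⟩
      level f * m
    ≤⟨ m≤m+n (level f * m) (toℕ f) ⟩
      key f
    ∎
    where open ≤-Reasoning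

  key<⇒level≤ : ∀ {e f} → key e < key f → level e ≤ level f
  key<⇒level≤ e<f = ≮⇒≥ λ f<e → <-asym e<f (key-mono f<e)

  key-injective : ∀ {e f} → key e ≡ key f → e ≡ f
  key-injective {e} {f} eq with <-cmp (level e) (level f)
  ... | tri< e<f _ _ = contradiction eq (<⇒≢ (key-mono e<f))
  ... | tri> _ _ f<e = contradiction (sym eq) (<⇒≢ (key-mono f<e))
  ... | tri≈ _ e≡f _ = Fin.toℕ-injective (+-cancelˡ-≡ (level e * m) _ _ (trans eq (cong (λ l → l * m + toℕ f) (sym e≡f))))

  open Galvin (Fin._≟_ {m}) (Fin._≟_ {n}) (Fin._≟_ {n}) a b key key-injective public

  deg : Fin n → ℕ
  deg v = # (inc? v) (N ++ X)

  deg-split : ∀ v → deg v ≡ # (inc? v) N + # (inc? v) X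
  deg-split v = #-++ (inc? v) N X

  κ-≤ : ∀ {e f} → e ∈ N → f ∈ N → key e < key f → κ e ≤ κ f
  κ-≤ e∈ f∈ e<f = ≤-pred (subst₂ _≤_ (level-N e∈) (level-N f∈) (key<⇒level≤ e<f))

  -- The edges of `N` that beat `e` at its `a`-end have distinct colours strictly between `κ e` and
  -- `r`. At the `b`-end the colours lie below `κ e` instead, so both ends together give at most `r`
  -- minus one such edges.
  above-N : ∀ {e} → e ∈ N → # (aboveAt? e) N ≤ r ∸ suc (κ e)
  above-N {e} e∈ = #-interval (aboveAt? e) unique κ (suc (κ e)) (r ∸ suc (κ e))
    (λ f∈ (af≡ , e<f) →
        ≤∧≢⇒< (κ-≤ e∈ f∈ e<f) (λ κ≡ → <⇒≢ e<f (cong key (sepᵃ e∈ f∈ (sym af≡) κ≡)))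
      , <-≤-trans (κ<r f∈) (≤-reflexive (sym (m+[n∸m]≡n (κ<r e∈)))))
    (λ x∈ y∈ (ax , _) (ay , _) → sepᵃ x∈ y∈ (trans ax (sym ay)))

  below-N : ∀ {e} → e ∈ N → # (belowAt? e) N ≤ κ e
  below-N {e} e∈ = #-interval (belowAt? e) unique κ 0 (κ e)
    (λ f∈ (bf≡ , f<e) → z≤n
      , ≤∧≢⇒< (κ-≤ f∈ e∈ f<e) (λ κ≡ → <⇒≢ f<e (cong key (sepᵇ f∈ e∈ bf≡ κ≡))))
    (λ x∈ y∈ (bx , _) (by , _) → sepᵇ x∈ y∈ (trans bx (sym by)))

  -- At a saturated `v` at least `r` of the `deg v` edges belong to `N`, which leaves at most the
  -- difference for `X`. At any other `v` no edge of `X` satisfies the predicate.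
  excess : ∀ {P : Fin m → Set} (P? : Decidable P) v → (∀ {f} → f ∈ X → P f → Inc v f × r ≤ # (inc? v) N) →
    # P? X ≤ deg v ∸ r
  excess P? v at with r ≤? # (inc? v) N
  ... | yes sat = m+n≤o⇒m≤o∸n _ (begin
      # P? X + r
    ≤⟨ +-mono-≤ (#-mono P? (inc? v) X λ f∈ → proj₁ ∘ at f∈) sat ⟩
      # (inc? v) X + # (inc? v) N
    ≡⟨ trans (+-comm (# (inc? v) X) _) (sym (deg-split v)) ⟩
      deg v
    ∎)
    where open ≤-Reasoning
  ... | no ¬sat = ≤-trans (≤-reflexive (#-none P? X λ f∈ pf → ¬sat (proj₂ (at f∈ pf)))) z≤n

  -- Level 0 lies below every edge of `N`, so an edge of `X` that beats `e` at the `a`-end has level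
  -- `suc r`, which by `level-X` comes with a saturated `a`-end.
  above-X : ∀ {e} → e ∈ N → # (aboveAt? e) X ≤ deg (a e) ∸ r
  above-X {e} e∈ = excess (aboveAt? e) (a e) λ {f} f∈ (af≡ , e<f) → inj₁ af≡ , sat f∈ af≡ (key<⇒level≤ e<f)
    where
    sat : ∀ {f} → f ∈ X → a f ≡ a e → level e ≤ level f → r ≤ # (inc? (a e)) N
    sat f∈ af≡ le with level-X f∈
    ... | inj₁ (l≡0 , _) = contradiction (subst₂ _≤_ (level-N e∈) l≡0 le) λ ()
    ... | inj₂ (_ , full) = subst (λ v → r ≤ # (inc? v) N) af≡ full

  below-X : ∀ {e} → e ∈ N → # (belowAt? e) X ≤ deg (b e) ∸ r
  below-X {e} e∈ = excess (belowAt? e) (b e) λ {f} f∈ (bf≡ , f<e) → inj₂ bf≡ , sat f∈ bf≡ (key<⇒level≤ f<e)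
    where
    sat : ∀ {f} → f ∈ X → b f ≡ b e → level f ≤ level e → r ≤ # (inc? (b e)) N
    sat f∈ bf≡ le with level-X f∈
    ... | inj₁ (_ , full)  = subst (λ v → r ≤ # (inc? v) N) bf≡ full
    ... | inj₂ (l≡sr , _) = contradiction (κ<r e∈) (≤⇒≯ (≤-pred (subst₂ _≤_ l≡sr (level-N e∈) le)))

  rank-N : ∀ {e} → e ∈ N → suc (rank e (N ++ X)) ≤ r + ((deg (a e) ∸ r) + (deg (b e) ∸ r))
  rank-N {e} e∈ = begin
      suc (rank e (N ++ X))
    ≡⟨ cong suc (cong₂ _+_ (#-++ (aboveAt? e) N X) (#-++ (belowAt? e) N X)) ⟩
      suc ((# (aboveAt? e) N + # (aboveAt? e) X) + (# (belowAt? e) N + # (belowAt? e) X))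
    ≤⟨ s≤s (+-mono-≤ (+-mono-≤ (above-N e∈) (above-X e∈)) (+-mono-≤ (below-N e∈) (below-X e∈))) ⟩
      suc ((r ∸ suc (κ e) + xᵃ) + (κ e + xᵇ))
    -- The colour `κ e` gained at the `b`-end is exactly what is lost at the `a`-end, so the bound
    -- does not depend on it.
    ≡⟨ solve 4 (λ s x k y → con 1 :+ ((s :+ x) :+ (k :+ y)) := ((con 1 :+ k) :+ s) :+ (x :+ y)) refl (r ∸ suc (κ e)) xᵃ (κ e) xᵇ ⟩
      (suc (κ e) + (r ∸ suc (κ e))) + (xᵃ + xᵇ)
    ≡⟨ cong (_+ (xᵃ + xᵇ)) (m+[n∸m]≡n (κ<r e∈)) ⟩
      r + (xᵃ + xᵇ)
    ∎
    where
    open ≤-Reasoning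
    xᵃ = deg (a e) ∸ r
    xᵇ = deg (b e) ∸ r

  few : ∀ {P : Fin m → Set} (P? : Decidable P) {v e} → e ∈ X → ¬ P e → Inc v e → (∀ {f} → P f → Inc v f) →
    # P? (N ++ X) < deg v
  few P? {v} e∈ ¬pe inc sub = #-strict P? (inc? v) (N ++ X) (λ _ → sub) (∈-++⁺ʳ N e∈) ¬pe inc

  few-saturated : ∀ {P : Fin m → Set} (P? : Decidable P) {v e} → e ∈ X → ¬ P e → Inc v e → (∀ {f} → P f → Inc v f) →
    (∀ {f} → f ∈ N → ¬ P f) → r ≤ # (inc? v) N → # P? (N ++ X) + r < deg v
  few-saturated P? {v} e∈ ¬pe inc sub none sat = begin-strict
      # P? (N ++ X) + r
    ≡⟨ cong (_+ r) (trans (#-++ P? N X) (cong (_+ # P? X) (#-none P? N none))) ⟩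
      # P? X + r
    <⟨ +-mono-<-≤ (#-strict P? (inc? v) X (λ _ → sub) e∈ ¬pe inc) sat ⟩
      # (inc? v) X + # (inc? v) N
    ≡⟨ trans (+-comm (# (inc? v) X) _) (sym (deg-split v)) ⟩
      deg v
    ∎
    where open ≤-Reasoning

  -- At the saturated end where `e` beats all of `N`, the at least `r` edges of `N` drop out of the
  -- count. At the other end all edges except `e` itself may be preferred.
  rank-X : ∀ {e} → e ∈ X → suc (rank e (N ++ X)) + r ≤ deg (a e) + deg (b e)
  rank-X {e} e∈ with level-X e∈
  ... | inj₁ (l≡0 , sat) = ≤-trans
      (≤-reflexive (cong suc (+-assoc (# (aboveAt? e) (N ++ X)) _ r)))
      (+-mono-≤
        (few (aboveAt? e) e∈ (<-irrefl refl ∘ proj₂) (inj₁ refl) (inj₁ ∘ proj₁))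
        (<⇒≤ (few-saturated (belowAt? e) e∈ (<-irrefl refl ∘ proj₂) (inj₂ refl) (inj₂ ∘ proj₁)
          (λ f∈ (_ , f<e) → contradiction (subst₂ _≤_ (level-N f∈) l≡0 (key<⇒level≤ f<e)) λ ()) sat)))
  ... | inj₂ (l≡sr , sat) = begin
      suc (rank e (N ++ X)) + r
    ≡⟨ solve 3 (λ x y z → con 1 :+ (x :+ y) :+ z := (con 1 :+ (x :+ z)) :+ y) refl (# (aboveAt? e) (N ++ X)) _ r ⟩
      suc (# (aboveAt? e) (N ++ X) + r) + # (belowAt? e) (N ++ X)
    ≤⟨ +-mono-≤
        (few-saturated (aboveAt? e) e∈ (<-irrefl refl ∘ proj₂) (inj₁ refl) (inj₁ ∘ proj₁)
          (λ f∈ (_ , e<f) → <⇒≱ (κ<r f∈) (≤-pred (subst₂ _≤_ l≡sr (level-N f∈) (key<⇒level≤ e<f)))) sat)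
        (<⇒≤ (few (belowAt? e) e∈ (<-irrefl refl ∘ proj₂) (inj₂ refl) (inj₂ ∘ proj₁))) ⟩
      deg (a e) + deg (b e)
    ∎
    where
    open ≤-Reasoning

  -- For `e` in `N` the end of degree at most `r` contributes no excess. For `e` in `X` the two
  -- degrees add up to at most `r + q`, and `rank-X` takes `r` off again.
  rank-bound : ∀ {e q} → e ∈ N ++ X → r ≤ q →
    deg (a e) ≤ r × deg (b e) ≤ q ⊎ deg (a e) ≤ q × deg (b e) ≤ r → rank e (N ++ X) < q
  rank-bound {e} {q} e∈ r≤q small with ∈-++⁻ N e∈
  rank-bound {e} {q} e∈ r≤q (inj₁ (a≤r , b≤q)) | inj₁ e∈N = ≤-trans (rank-N e∈N)
    (≤-trans (≤-reflexive (cong (λ x → r + (x + (deg (b e) ∸ r))) (m≤n⇒m∸n≡0 a≤r))) (m+[n∸m]≤o r≤q b≤q))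
  rank-bound {e} {q} e∈ r≤q (inj₂ (a≤q , b≤r)) | inj₁ e∈N = ≤-trans (rank-N e∈N)
    (≤-trans (≤-reflexive (cong (r +_) (trans (cong ((deg (a e) ∸ r) +_) (m≤n⇒m∸n≡0 b≤r)) (+-identityʳ _)))) (m+[n∸m]≤o r≤q a≤q))
  rank-bound {e} {q} e∈ r≤q (inj₁ (a≤r , b≤q)) | inj₂ e∈X = +-cancelʳ-≤ r _ _
    (≤-trans (rank-X e∈X) (≤-trans (+-mono-≤ a≤r b≤q) (≤-reflexive (+-comm r q))))
  rank-bound {e} {q} e∈ r≤q (inj₂ (a≤q , b≤r)) | inj₂ e∈X = +-cancelʳ-≤ r _ _
    (≤-trans (rank-X e∈X) (+-mono-≤ a≤q b≤r))

-- Assembling the colouring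

Unique-resp-↭ : {A : Set} {xs ys : List A} → xs ↭ ys → Unique xs → Unique ys
Unique-resp-↭ {A} = Permutationₛ.Unique-resp-↭ (setoid A) ∘ ↭⇒↭ₛ

Unique-++⁻ : {A : Set} (xs : List A) {ys : List A} → Unique (xs ++ ys) →
  Unique xs × Unique ys × (∀ {x} → x ∈ ys → x ∉ xs)
Unique-++⁻ []       u = AllPairs.[] , u , λ _ ()
Unique-++⁻ (x ∷ xs) {ys} u@(x≢ AllPairs.∷ u') with uxs , uys , disj ← Unique-++⁻ xs u' =
  All.++⁻ˡ xs x≢ AllPairs.∷ uxs , uys , λ where
    x∈ (here refl)  → Unique[x∷xs]⇒x∉xs u (∈-++⁺ʳ xs x∈)
    y∈ (there y∈xs) → disj y∈ y∈xs

-- The lists are nested: `S` is precoloured, `I` lies inside the parts and `O` crosses; `O` splits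
-- into `taken` and `L`, and `L` into `N` and `X`. The edges of `Z` are coloured first, and those of
-- `N ++ X` from the lists that remain.
module Extension {m n : ℕ} (a b : Fin m → Fin n) (side : Fin n → Bool) (S I O taken L N X : List (Fin m)) (Δ T : ℕ)
  where

  open Incidence {V = Fin n} Fin._≟_ a b

  Z : List (Fin m)
  Z = taken ++ (I ++ S)

  r : ℕ
  r = Δ ∸ T

  module _
    (crossing : ∀ {e} → e ∈ O → side (a e) ≡ true × side (b e) ≡ false)
    (unique : Unique ((I ++ S) ++ O))
    (degree : ∀ v → # (inc? v) (I ++ S) + # (inc? v) O ≤ Δ)
    (c₀ : Fin m → ℕ) (c₀<K : ∀ {e} → e ∈ S → c₀ e < Δ + T) (c₀-proper : Proper c₀ S)
    (O-split : taken ++ L ↭ O)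
    (Z-bounded : ∀ v → # (inc? v) Z ≤ T)
    (Z-saturated : ∀ {e} → e ∈ L → T ≤ # (inc? (a e)) Z ⊎ T ≤ # (inc? (b e)) Z)
    (L-split : N ++ X ↭ L)
    (N-bounded : ∀ v → # (inc? v) N ≤ r)
    (N-saturated : ∀ {e} → e ∈ X → r ≤ # (inc? (a e)) N ⊎ r ≤ # (inc? (b e)) N)
    where

    Z++L↭ : Z ++ (N ++ X) ↭ (I ++ S) ++ O
    Z++L↭ = ↭-trans (++⁺ˡ Z L-split) (↭-trans (↭-reflexive (++-assoc taken (I ++ S) L))
              (↭-trans (shifts taken (I ++ S)) (++⁺ˡ (I ++ S) O-split)))

    Z,L-unique : Unique Z × Unique (N ++ X) × (∀ {x} → x ∈ N ++ X → x ∉ Z)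
    Z,L-unique = Unique-++⁻ Z (Unique-resp-↭ (↭-sym Z++L↭) unique)

    N,X-unique : Unique N × Unique X × (∀ {x} → x ∈ X → x ∉ N)
    N,X-unique = Unique-++⁻ N (proj₁ (proj₂ Z,L-unique))

    open Preference a b N X r (proj₁ N,X-unique) (proj₂ (proj₂ N,X-unique)) N-bounded N-saturated

    deg+Z≤Δ : ∀ v → deg v + # (inc? v) Z ≤ Δ
    deg+Z≤Δ v = begin
        # (inc? v) (N ++ X) + # (inc? v) Z
      ≡⟨ +-comm (# (inc? v) (N ++ X)) _ ⟩
        # (inc? v) Z + # (inc? v) (N ++ X)
      ≡⟨ trans (sym (#-++ (inc? v) Z (N ++ X))) (trans (#-↭ (inc? v) Z++L↭) (#-++ (inc? v) (I ++ S) O)) ⟩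
        # (inc? v) (I ++ S) + # (inc? v) O
      ≤⟨ degree v ⟩
        Δ
      ∎
      where open ≤-Reasoning

    greedyColouring : Σ (Fin m → ℕ) λ c → (∀ {e} → e ∈ S → c e ≡ c₀ e) × (∀ {e} → e ∈ Z → c e < Δ + T) × Proper c Z
    greedyColouring = subst
      (λ zs → Unique zs → (∀ u v → # (inc? u) zs + # (inc? v) zs ≤ Δ + T) → Σ (Fin m → ℕ) λ c →
        (∀ {e} → e ∈ S → c e ≡ c₀ e) × (∀ {e} → e ∈ zs → c e < Δ + T) × Proper c zs)
      (++-assoc taken I S)
      (greedy (Fin._≟_ {m}) S (taken ++ I) c₀ c₀<K c₀-proper)
      (proj₁ Z,L-unique)
      -- One end is bounded by the maximum degree `Δ` and the other by `T`; together they make up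
      -- the palette size.
      (λ u v → +-mono-≤ (m+n≤o⇒n≤o (deg u) (deg+Z≤Δ u)) (Z-bounded v))

    near? : ∀ e → Decidable (λ x → Inc (a e) x ⊎ Inc (b e) x)
    near? e x = inc? (a e) x ⊎-dec inc? (b e) x

    Allowed : (Fin m → ℕ) → Fin m → ℕ → Set
    Allowed c e γ = ¬ (∃ λ x → x ∈ Z × (Inc (a e) x ⊎ Inc (b e) x) × c x ≡ γ)

    allowed? : ∀ c e → Decidable (Allowed c e)
    allowed? c e = unused? (near? e) c Z

    -- At most `xᵃ + xᵇ` of the `Δ + T` colours are forbidden, and each summand is at most `T`,
    -- whence `r ≤ q`. By saturation one end has `T` edges in `Z` and thus at most `r` remaining
    -- ones. At the other end `Δ` minus its edges in `Z` bounds the rest, and `q` is at least that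
    -- large because the first end forbids at most `T` colours.
    rank<allowed : ∀ c → ∀ {e} → e ∈ N ++ X → rank e (N ++ X) < # (allowed? c e) (downFrom (Δ + T))
    rank<allowed c {e} e∈ = rank-bound e∈ r≤q small
      where
      open ≤-Reasoning
      q = # (allowed? c e) (downFrom (Δ + T))
      xᵃ = # (inc? (a e)) Z
      xᵇ = # (inc? (b e)) Z
      enough : Δ + T ≤ q + (xᵃ + xᵇ)
      enough = ≤-trans (#-unused (near? e) c Z (Δ + T))
        (+-monoʳ-≤ q (#-cover (inc? (a e)) (inc? (b e)) (near? e) Z λ _ → id))
      r≤q : r ≤ q
      r≤q = m≤n+o⇒m∸n≤o Δ T (+-cancelʳ-≤ T Δ (T + q) (begin
          Δ + T
        ≤⟨ enough ⟩
          q + (xᵃ + xᵇ)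
        ≤⟨ +-monoʳ-≤ q (+-mono-≤ (Z-bounded (a e)) (Z-bounded (b e))) ⟩
          q + (T + T)
        ≡⟨ solve 2 (λ q t → q :+ (t :+ t) := t :+ q :+ t) refl q T ⟩
          T + q + T
        ∎))
      full : ∀ v → T ≤ # (inc? v) Z → deg v ≤ r
      full v T≤ = m+n≤o⇒m≤o∸n (deg v) (≤-trans (+-monoʳ-≤ (deg v) T≤) (deg+Z≤Δ v))
      fits : ∀ v {x y} → Δ + T ≤ q + (x + y) → y ≤ T → deg v + x ≤ Δ → deg v ≤ q
      fits v {x} {y} le y≤T deg≤ = +-cancelʳ-≤ (x + T) (deg v) q (begin
          deg v + (x + T)
        ≡⟨ sym (+-assoc (deg v) x T) ⟩
          deg v + x + T
        ≤⟨ +-monoˡ-≤ T deg≤ ⟩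
          Δ + T
        ≤⟨ le ⟩
          q + (x + y)
        ≤⟨ +-monoʳ-≤ q (+-monoʳ-≤ x y≤T) ⟩
          q + (x + T)
        ∎)
      small : deg (a e) ≤ r × deg (b e) ≤ q ⊎ deg (a e) ≤ q × deg (b e) ≤ r
      small with Z-saturated (∈-resp-↭ L-split e∈)
      ... | inj₁ T≤ = inj₁ (full (a e) T≤
                        , fits (b e) (≤-trans enough (≤-reflexive (cong (q +_) (+-comm xᵃ xᵇ)))) (Z-bounded (a e)) (deg+Z≤Δ (b e)))
      ... | inj₂ T≤ = inj₂ (fits (a e) enough (Z-bounded (b e)) (deg+Z≤Δ (a e)) , full (b e) T≤)

    listColouringOfRest : ∀ c → Σ (Fin m → ℕ) λ d →
      (∀ {e} → e ∈ N ++ X → d e ∈ downFrom (Δ + T) × Allowed c e (d e)) ×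
      Separates a d (N ++ X) × Separates b d (N ++ X)
    listColouringOfRest c = listColouring (allowed? c) 0 (downFrom (Δ + T)) (downFrom⁺ (Δ + T)) (N ++ X) (rank<allowed c)

    -- An `a`-end and a `b`-end lie on different sides of the cut, so two crossing edges can only
    -- meet in ends of the same kind.
    Separates⇒Proper : ∀ {d : Fin m → ℕ} → Separates a d (N ++ X) → Separates b d (N ++ X) → Proper d (N ++ X)
    Separates⇒Proper sepᵃ sepᵇ {v} {x} {y} x∈ y∈ ix iy d≡ = meet ix iy
      where
      cross : ∀ {e} → e ∈ N ++ X → side (a e) ≡ true × side (b e) ≡ false
      cross e∈ = crossing (∈-resp-↭ O-split (∈-++⁺ʳ taken (∈-resp-↭ L-split e∈)))
      apart : ∀ {e f} → e ∈ N ++ X → f ∈ N ++ X → a e ≢ b f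
      apart e∈ f∈ eq with () ← trans (sym (proj₁ (cross e∈))) (trans (cong side eq) (proj₂ (cross f∈)))
      meet : Inc v x → Inc v y → x ≡ y
      meet (inj₁ ax) (inj₁ ay) = sepᵃ x∈ y∈ (trans ax (sym ay)) d≡
      meet (inj₂ bx) (inj₂ by) = sepᵇ x∈ y∈ (trans bx (sym by)) d≡
      meet (inj₁ ax) (inj₂ by) = contradiction (trans ax (sym by)) (apart x∈ y∈)
      meet (inj₂ bx) (inj₁ ay) = contradiction (trans ay (sym bx)) (apart y∈ x∈)

    near : ∀ {v e x} → Inc v e → Inc v x → Inc (a e) x ⊎ Inc (b e) x
    near (inj₁ refl) inc = inj₁ inc
    near (inj₂ refl) inc = inj₂ inc

    extension : Σ (Fin m → ℕ) λ f →
      (∀ {e} → e ∈ S → f e ≡ c₀ e) × (∀ {e} → e ∈ (I ++ S) ++ O → f e < Δ + T) × Proper f ((I ++ S) ++ O)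
    extension
      with c , c≡c₀ , c<K , c-proper ← greedyColouring
      with d , d-allowed , sepᵃ , sepᵇ ← listColouringOfRest c
      with f , f≡c , f≡d , f-proper ← Proper-++ (Fin._≟_ {m}) Z (N ++ X) c-proper (Separates⇒Proper sepᵃ sepᵇ)
             (λ x∈ y∈ ix iy c≡d → proj₂ (d-allowed y∈) (_ , x∈ , near iy ix , c≡d))
      = f
      , (λ e∈ → trans (f≡c (∈-++⁺ʳ taken (∈-++⁺ʳ I e∈))) (c≡c₀ e∈))
      , (λ e∈ → f<K (∈-++⁻ Z (∈-resp-↭ (↭-sym Z++L↭) e∈)))
      , (λ x∈ y∈ → f-proper (∈-resp-↭ (↭-sym Z++L↭) x∈) (∈-resp-↭ (↭-sym Z++L↭) y∈))
      where
      f<K : ∀ {e} → e ∈ Z ⊎ e ∈ N ++ X → f e < Δ + T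
      f<K (inj₁ e∈) = subst (_< Δ + T) (sym (f≡c e∈)) (c<K e∈)
      f<K (inj₂ e∈) = subst (_< Δ + T) (sym (f≡d e∈ (proj₂ (proj₂ Z,L-unique) e∈))) (∈-downFrom⁻ (proj₁ (d-allowed e∈)))

module _ {m n : ℕ} (a b : Fin m → Fin n) where

  open Incidence {V = Fin n} Fin._≟_ a b

  extendBipartite : (side : Fin n → Bool) (S I O : List (Fin m)) (Δ T : ℕ) →
    (∀ {e} → e ∈ O → side (a e) ≡ true × side (b e) ≡ false) → Unique ((I ++ S) ++ O) →
    (∀ v → # (inc? v) (I ++ S) ≤ T) → (∀ v → # (inc? v) (I ++ S) + # (inc? v) O ≤ Δ) →
    (c : Fin m → ℕ) → (∀ {e} → e ∈ S → c e < Δ + T) → Proper c S →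
    Σ (Fin m → ℕ) λ f →
      (∀ {e} → e ∈ S → f e ≡ c e) × (∀ {e} → e ∈ (I ++ S) ++ O → f e < Δ + T) × Proper f ((I ++ S) ++ O)
  extendBipartite side S I O Δ T crossing unique small degree c c<K c-proper =
    Extension.extension a b side S I O (taken s₁) (left s₁) (taken s₂) (left s₂) Δ T crossing unique degree
      c c<K c-proper (split s₁) (bounded s₁) (saturated s₁) (split s₂)
      (λ v → subst (λ es → # (inc? v) es ≤ r) (++-identityʳ (taken s₂)) (bounded s₂ v))
      (λ {e} e∈ → subst (λ es → r ≤ # (inc? (a e)) es ⊎ r ≤ # (inc? (b e)) es) (++-identityʳ (taken s₂)) (saturated s₂ e∈))
    where
    open Saturation
    r = Δ ∸ T
    -- The first choice counts `I ++ S` in advance, since those edges restrict the lists. The second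
    -- starts from nothing, because `N` is bounded on its own.
    s₁ = saturate T (I ++ S) O small
    s₂ = saturate r [] (left s₁) (λ _ → z≤n)

-- From lists of edges back to the precoloured multigraph

paletteSize-split : ∀ Δ k → paletteSize Δ k ≡ Δ + (Δ + k) / 2
paletteSize-split Δ k = begin
    (3 * Δ + k) / 2
  -- The even summand `Δ * 2` is isolated so that it can leave the floor exactly.
  ≡⟨ cong (_/ 2) (solve 2 (λ d k → con 3 :* d :+ k := d :* con 2 :+ (d :+ k)) refl Δ k) ⟩
    (Δ * 2 + (Δ + k)) / 2
  ≡⟨ +-distrib-/-∣ˡ {Δ * 2} (Δ + k) (divides-refl Δ) ⟩
    Δ * 2 / 2 + (Δ + k) / 2
  ≡⟨ cong (_+ (Δ + k) / 2) (m*n/n≡m Δ 2) ⟩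
    Δ + (Δ + k) / 2
  ∎
  where
  open ≡-Reasoning

half-≤ : ∀ {x y} → x + x ≤ y → x ≤ y / 2
half-≤ {x} {y} le = ≤-trans (≤-reflexive (sym (m*n/n≡m x 2))) (/-monoˡ-≤ 2 (≤-trans (≤-reflexive x*2≡x+x) le))
  where x*2≡x+x = trans (*-comm x 2) (cong (x +_) (+-identityʳ x))

module Precoloured (G : Multigraph) (Δ k : ℕ) (degree≤Δ : ∀ v → degree G v ≤ Δ)
  (pre : Fin (m G) → Maybe (Fin (paletteSize Δ k))) (pre-proper : ProperPrecolouring G (Fin (paletteSize Δ k)) pre)
  (sDegree≤k : ∀ v → sDegree G pre v ≤ k) where

  private
    E = Fin (m G)
    V = Fin (n G)
    p q : E → V
    p = proj₁ ∘ ends G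
    q = proj₂ ∘ ends G
    all = allFin (m G)

  coloured? : Decidable (λ e → T (is-just (pre e)))
  coloured? e = T? (is-just (pre e))

  S U : List E
  S = filter coloured? all
  U = filter (¬? ∘ coloured?) all

  open MaxCut p q (loopless G) U

  half : ℕ
  half = (Δ + k) / 2

  -- The value 0 on uncoloured edges is a placeholder; the statements about `c` concern edges of
  -- `S`.
  c : E → ℕ
  c e = maybe′ toℕ 0 (pre e)

  value : ∀ {e} → e ∈ S → ∃ λ γ → pre e ≡ just γ × c e ≡ toℕ γ
  value {e} e∈ with pre e | proj₂ (∈-filter⁻ coloured? {xs = all} e∈)
  ... | just γ | _ = γ , refl , refl

  value⁻ : ∀ {e γ} → pre e ≡ just γ → e ∈ S × c e ≡ toℕ γ
  value⁻ {e} pre≡ = ∈-filter⁺ coloured? (∈-allFin e) (subst (T ∘ is-just) (sym pre≡) _) , cong (maybe′ toℕ 0) pre≡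

  module _ (side : V → Bool) (inner≤outer : ∀ v → inner side v ≤ outer side v) where

    -- The ends are reordered so that a crossing edge has its `a`-end on the side `true`. For an
    -- edge inside a part this is merely some order of its two ends.
    a b : E → V
    a e = if side (p e) then p e else q e
    b e = if side (p e) then q e else p e

    open Incidence {V = V} Fin._≟_ a b

    inc⇒incident : ∀ {v e} → Inc v e → IncidentTo G v e
    inc⇒incident {v} {e} inc with side (p e)
    ... | true  = inc
    ... | false = Sum.swap inc

    incident⇒inc : ∀ {v e} → IncidentTo G v e → Inc v e
    incident⇒inc {v} {e} inc with side (p e)
    ... | true  = inc
    ... | false = Sum.swap inc

    I O : List E
    I = filter (¬? ∘ cross? side) U
    O = filter (cross? side) U

    crossing : ∀ {e} → e ∈ O → side (a e) ≡ true × side (b e) ≡ false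
    crossing {e} e∈ with cr ← proj₂ (∈-filter⁻ (cross? side) {xs = U} e∈) | side (p e) in eqp | side (q e) in eqq
    ... | true  | true  = contradiction refl cr
    ... | true  | false = eqp , eqq
    ... | false | true  = eqq , eqp
    ... | false | false = contradiction refl cr

    ↭all : (I ++ S) ++ O ↭ all
    ↭all = ↭-trans (++⁺ʳ O (++-comm I S)) (↭-trans (↭-reflexive (++-assoc S I O))
      (↭-trans (++⁺ˡ S (↭-trans (++-comm I O) (filter-partition (cross? side) U))) (filter-partition coloured? all)))

    degree' : ∀ v → # (inc? v) (I ++ S) + # (inc? v) O ≤ Δ
    degree' v = begin
        # (inc? v) (I ++ S) + # (inc? v) O
      ≡⟨ trans (sym (#-++ (inc? v) (I ++ S) O)) (#-↭ (inc? v) ↭all) ⟩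
        # (inc? v) all
      ≤⟨ #-mono (inc? v) (incident? G v) all (λ _ → inc⇒incident) ⟩
        degree G v
      ≤⟨ degree≤Δ v ⟩
        Δ
      ∎
      where open ≤-Reasoning

    S≤k : ∀ v → # (inc? v) S ≤ k
    S≤k v = begin
        # (inc? v) S
      ≡⟨ #-filter (inc? v) coloured? all ⟩
        # (λ e → inc? v e ×-dec coloured? e) all
      ≤⟨ #-mono _ (λ e → coloured? e ×-dec incident? G v e) all (λ _ (inc , col) → col , inc⇒incident inc) ⟩
        # (λ e → coloured? e ×-dec incident? G v e) all
      ≡⟨ sym (#-filter coloured? (incident? G v) all) ⟩
        sDegree G pre v
      ≤⟨ sDegree≤k v ⟩
        k
      ∎
      where open ≤-Reasoning

    I≤O : ∀ v → # (inc? v) I ≤ # (inc? v) O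
    I≤O v = begin
        # (inc? v) I
      ≡⟨ #-filter (inc? v) (¬? ∘ cross? side) U ⟩
        # (λ e → inc? v e ×-dec ¬? (cross? side e)) U
      ≤⟨ #-mono _ _ U (λ _ (inc , ¬cr) → inc⇒incident inc , ¬cr) ⟩
        inner side v
      ≤⟨ inner≤outer v ⟩
        outer side v
      ≤⟨ #-mono _ (λ e → inc? v e ×-dec cross? side e) U (λ _ (inc , cr) → incident⇒inc inc , cr) ⟩
        # (λ e → inc? v e ×-dec cross? side e) U
      ≡⟨ sym (#-filter (inc? v) (cross? side) U) ⟩
        # (inc? v) O
      ∎
      where open ≤-Reasoning

    -- In twice the count, one copy of the inside edges is exchanged for crossing edges by local
    -- maximality and one copy of `S` for `k`. What is left counts distinct edges at `v`, at most
    -- `Δ`.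
    I++S≤half : ∀ v → # (inc? v) (I ++ S) ≤ half
    I++S≤half v = half-≤ (begin
        x + x
      ≡⟨ cong (x +_) (#-++ (inc? v) I S) ⟩
        x + (# (inc? v) I + # (inc? v) S)
      ≤⟨ +-monoʳ-≤ x (+-mono-≤ (I≤O v) (S≤k v)) ⟩
        x + (# (inc? v) O + k)
      ≡⟨ sym (+-assoc x _ k) ⟩
        x + # (inc? v) O + k
      ≤⟨ +-monoˡ-≤ k (degree' v) ⟩
        Δ + k
      ∎)
      where
      open ≤-Reasoning
      x = # (inc? v) (I ++ S)

    c-proper : Proper c S
    c-proper {v} {x} {y} x∈ y∈ ix iy c≡
      with α , preˣ , cˣ ← value x∈ | β , preʸ , cʸ ← value y∈ | x Fin.≟ y
    ... | yes x≡y = x≡y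
    ... | no x≢y  = contradiction (Fin.toℕ-injective (trans (sym cˣ) (trans c≡ cʸ)))
                      (pre-proper x y α β (x≢y , v , inc⇒incident ix , inc⇒incident iy) preˣ preʸ)

    c<K : ∀ {e} → e ∈ S → c e < Δ + half
    c<K {e} e∈ with γ , _ , c≡ ← value e∈ =
      subst₂ _<_ (sym c≡) (paletteSize-split Δ k) (Fin.toℕ<n γ)

    package : (Σ (E → ℕ) λ f →
        (∀ {e} → e ∈ S → f e ≡ c e) × (∀ {e} → e ∈ (I ++ S) ++ O → f e < Δ + half) × Proper f ((I ++ S) ++ O)) →
      Σ (E → Fin (paletteSize Δ k)) λ f → ProperColouring G (Fin (paletteSize Δ k)) f × Extends G pre f
    package (f , f≡c , f<K , f-proper) = (λ e → fromℕ< (f<palette e)) , proper , extends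
      where
      member : ∀ e → e ∈ (I ++ S) ++ O
      member e = ∈-resp-↭ (↭-sym ↭all) (∈-allFin e)
      f<palette : ∀ e → f e < paletteSize Δ k
      f<palette e = subst (f e <_) (sym (paletteSize-split Δ k)) (f<K (member e))
      proper : ProperColouring G (Fin (paletteSize Δ k)) (λ e → fromℕ< (f<palette e))
      proper x y (x≢y , v , ix , iy) eq = x≢y (f-proper (member x) (member y) (incident⇒inc ix) (incident⇒inc iy)
        (trans (sym (Fin.toℕ-fromℕ< _)) (trans (cong toℕ eq) (Fin.toℕ-fromℕ< _))))
      extends : Extends G pre (λ e → fromℕ< (f<palette e))
      extends e γ pre≡ with e∈ , c≡ ← value⁻ pre≡ =
        Fin.toℕ-injective (trans (Fin.toℕ-fromℕ< _) (trans (f≡c e∈) c≡))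

    extendAlongCut : Σ (E → Fin (paletteSize Δ k)) λ f → ProperColouring G (Fin (paletteSize Δ k)) f × Extends G pre f
    extendAlongCut = package (extendBipartite a b side S I O Δ half crossing
      (Unique-resp-↭ (↭-sym ↭all) (allFin⁺ (m G))) I++S≤half degree' c c<K c-proper)

theorem2p2 : (G : Multigraph) (Δ k : ℕ) → IsMaxDegree G Δ → 1 ≤ k →
    (pre : Fin (m G) → Maybe (Fin (paletteSize Δ k))) →
    ProperPrecolouring G (Fin (paletteSize Δ k)) pre →
    ((v : Fin (n G)) → sDegree G pre v ≤ k) →
    Σ (Fin (m G) → Fin (paletteSize Δ k)) (λ c →
    ProperColouring G (Fin (paletteSize Δ k)) c × Extends G pre c)
theorem2p2 G Δ k (degree≤Δ , _) _ pre pre-proper sDegree≤k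
  -- The search starts with all vertices on one side; the number of uncoloured edges bounds the
  -- possible improvements.
  with side , inner≤outer ← MaxCut.locallyMaximal (proj₁ ∘ ends G) (proj₂ ∘ ends G) (loopless G)
         (Precoloured.U G Δ k degree≤Δ pre pre-proper sDegree≤k)
         (length (Precoloured.U G Δ k degree≤Δ pre pre-proper sDegree≤k)) (λ _ → true) (m≤n+m _ _)
  = Precoloured.extendAlongCut G Δ k degree≤Δ pre pre-proper sDegree≤k side inner≤outer
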